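{- Let $\rho$ be a positive integer. Then $$\zeta(3)=\frac{7\rho+12}{6\rho+10}+\sum_{n\ge1}\frac{\Phi_n^{(\rho)}}{2n^4(n+1)^4\,\Theta_n^{(\rho)}\,\Theta_{n+1}^{(\rho)}},$$ where $$\Theta_n^{(\rho)}=\frac{\rho n+1}{n}\;{}_5F_4\!\left(\begin{matrix}n+1,\;n,\;-n,\;-n,\;\rho n+2\\ 1,\;1,\;1,\;\rho n+1\end{matrix}\;\middle|\;1\right)$$ and $$\Phi_n^{(\rho)}=24n^5\rho^2-12n^5+54n^4\rho^2+39n^4\rho-33n^4+46n^3\rho^2+70n^3\rho+19n^2\rho^2+56n^2\rho+33n^2+3n\rho^2+21n\rho+24n+3\rho+5.$$
   Context: $(a)_k=\prod_{j=0}^{k-1}(a+j)$, $(a)_0=1$. The generalized hypergeometric series is ${}_rF_s\!\left(\begin{matrix}a_1,\dots,a_r\\ b_1,\dots,b_s\end{matrix}\middle| z\right)=\sum_{k\ge0}\frac{(a_1)_k\cdots(a_r)_k}{(b_1)_k\cdots(b_s)_k}\frac{z^k}{k!}$ (here it terminates since $(-n)_k=0$ for $k>n$). $\zeta(3)=\sum_{m\ge1}m^{ -3}$. -}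

module Defs where

open import Data.Nat as ℕ using (ℕ; zero; suc)
open import Data.Integer as ℤ using (ℤ; +_)
open import Data.Rational using (ℚ; 0ℚ; 1ℚ; _+_; _*_; _-_; -_; 1/_; _≟_; ≢-nonZero)
open import Data.List using (List; []; _∷_; foldr)
open import Relation.Nullary using (yes; no)

-- total reciprocal on ℚ (convention 1/0 = 0, only used where denominators are nonzero)
inv : ℚ → ℚ
inv q with q ≟ 0ℚ
... | yes _ = 0ℚ
... | no q≢0 = 1/_ q {{≢-nonZero q≢0}}

_÷'_ : ℚ → ℚ → ℚ
p ÷' q = p * inv q

infixl 7 _÷'_

ℕ→ℚ : ℕ → ℚ
ℕ→ℚ n = Data.Rational.fromℚᵘ (Data.Rational.Unnormalised.mkℚᵘ (+ n) 0)
  where import Data.Rational.Unnormalised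
ℤ→ℚ : ℤ → ℚ
ℤ→ℚ z = Data.Rational.fromℚᵘ (Data.Rational.Unnormalised.mkℚᵘ z 0)
  where import Data.Rational.Unnormalised

poch : ℚ → ℕ → ℚ
poch a zero = 1ℚ
poch a (suc k) = poch a k * (a + ℕ→ℚ k)

factorial : ℕ → ℚ
factorial zero = 1ℚ
factorial (suc k) = factorial k * ℕ→ℚ (suc k)

Σ< : ℕ → (ℕ → ℚ) → ℚ
Σ< zero f = 0ℚ
Σ< (suc N) f = Σ< N f + f N

powℚ : ℚ → ℕ → ℚ
powℚ z zero = 1ℚ
powℚ z (suc k) = powℚ z k * z

prodPoch : List ℚ → ℕ → ℚ
prodPoch as k = foldr (λ a r → poch a k * r) 1ℚ as

hypTerm : List ℚ → List ℚ → ℚ → ℕ → ℚ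
hypTerm as bs z k =
  (prodPoch as k * powℚ z k) ÷' (prodPoch bs k * factorial k)

-- the series truncated to its first N terms (exact when it terminates before N)
hypSum : ℕ → List ℚ → List ℚ → ℚ → ℚ
hypSum N as bs z = Σ< N (hypTerm as bs z)

-- Θ_n^(ρ) = (ρn+1)/n · 5F4(n+1, n, -n, -n, ρn+2; 1, 1, 1, ρn+1 | 1);
-- the series terminates: (-n)_k = 0 for k > n, so summing k = 0..n is the full sum.
Θ : ℕ → ℕ → ℚ
Θ ρ n =
  (ℕ→ℚ (ρ ℕ.* n ℕ.+ 1) ÷' ℕ→ℚ n) *
  hypSum (suc n)
    (ℕ→ℚ (n ℕ.+ 1) ∷ ℕ→ℚ n ∷ - ℕ→ℚ n ∷ - ℕ→ℚ n ∷ ℕ→ℚ (ρ ℕ.* n ℕ.+ 2) ∷ [])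
    (1ℚ ∷ 1ℚ ∷ 1ℚ ∷ ℕ→ℚ (ρ ℕ.* n ℕ.+ 1) ∷ [])
    1ℚ

Φ : ℕ → ℕ → ℚ
Φ ρ n = ℤ→ℚ
  ( + 24 ℤ.* N ^5 ℤ.* R ^2 ℤ.- + 12 ℤ.* N ^5 ℤ.+ + 54 ℤ.* N ^4 ℤ.* R ^2
  ℤ.+ + 39 ℤ.* N ^4 ℤ.* R ℤ.- + 33 ℤ.* N ^4 ℤ.+ + 46 ℤ.* N ^3 ℤ.* R ^2
  ℤ.+ + 70 ℤ.* N ^3 ℤ.* R ℤ.+ + 19 ℤ.* N ^2 ℤ.* R ^2 ℤ.+ + 56 ℤ.* N ^2 ℤ.* R
  ℤ.+ + 33 ℤ.* N ^2 ℤ.+ + 3 ℤ.* N ℤ.* R ^2 ℤ.+ + 21 ℤ.* N ℤ.* R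
  ℤ.+ + 24 ℤ.* N ℤ.+ + 3 ℤ.* R ℤ.+ + 5 )
  where
  N R : ℤ
  N = + n
  R = + ρ
  _^2 _^3 _^4 _^5 : ℤ → ℤ
  x ^2 = x ℤ.* x
  x ^3 = x ^2 ℤ.* x
  x ^4 = x ^3 ℤ.* x
  x ^5 = x ^4 ℤ.* x
  infixl 8 _^2 _^3 _^4 _^5

summand : ℕ → ℕ → ℚ
summand ρ n =
  Φ ρ n ÷' (ℕ→ℚ (2 ℕ.* n ℕ.^ 4 ℕ.* (n ℕ.+ 1) ℕ.^ 4) * Θ ρ n * Θ ρ (n ℕ.+ 1))

seriesPartial : ℕ → ℕ → ℚ
seriesPartial ρ M = Σ< M (λ k → summand ρ (suc k))

zeta3Partial : ℕ → ℚ
zeta3Partial M = Σ< M (λ k → inv (ℕ→ℚ (suc k ℕ.^ 3)))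

const : ℕ → ℚ
const ρ = ℕ→ℚ (7 ℕ.* ρ ℕ.+ 12) ÷' ℕ→ℚ (6 ℕ.* ρ ℕ.+ 10)

{-# OPTIONS --safe #-}

-- Expanding the hypergeometric term, Θ_n = Σ_k λ_{n,k} (ρn+1+k)/(n+k) with λ_{n,k} = C(n,k)² C(n+k,k)², the
-- weights of Apéry's numbers a_n = Σ_k λ_{n,k} and b_n = Σ_k λ_{n,k} c_{n,k}.  A telescoping sum over k gives
-- 12 n Σ_k λ_{n,k}/(n+k) = 7 a_n + a_{n-1}, so 12 n Θ_n = α_n a_n + σ_n a_{n-1} with σ_n = (ρ-1)n + 1 and
-- α_n = 12 n + 7 σ_n.  Put 12 n P_n = α_n b_n + σ_n b_{n-1}.  Apéry's recurrence and the Casoratian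
-- n³ (b_n a_{n-1} - a_n b_{n-1}) = 6 show that the n-th summand is P_{n+1}/Θ_{n+1} - P_n/Θ_n, so the partial sums
-- are P_n/Θ_n.  These are weighted means of b_n/a_n and b_{n-1}/a_{n-1}, hence tend to ζ(3), because every
-- c_{n,k} with k ≤ n is within 1/n of the partial sum of ζ(3).
module Submission where

-- The multiplier `σ` comes from (ρn+1+k)/(n+k) = 1 + σ_n/(n+k), which leaves Θ_n = a_n + σ_n Σ_k
-- λ_{n,k}/(n+k). Apéry's auxiliary numbers are c_{n,k} = Σ_{m≤n} 1/m³ + Σ_{1≤m≤k} (-1)^(m-1) / (2
-- m³ C(n,m) C(n+m,m)). Each recurrence is proved by an explicit antidifference in k, so that a
-- single step becomes a polynomial identity. The obstacle is the denominators: three neighbouring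
-- rows have to be summed over one common range of k, where C(n,m) may vanish and `inv` returns 0.
-- Hence the identities are arranged so that a vanishing weight annihilates both sides, and the
-- closed form of c_{n+1,k} - c_{n,k} is invoked only where C(n,k) is nonzero. As ζ(3) is the limit
-- of `zeta3Partial`, convergence is expressed within ℚ: the M-th partial sums of both sides differ
-- by less than any ε > 0 for all large M.

open import Defs
open import Defs using () renaming (ℕ→ℚ to κ)
open import Algebra.Bundles using (CommutativeRing)
import Algebra.Solver.Ring as RingSolver
open import Algebra.Solver.Ring.AlmostCommutativeRing using (fromCommutativeRing; _-Raw-AlmostCommutative⟶_)
open import Data.Integer as ℤ using (ℤ; +_)
import Data.Integer.Properties as ℤ
open import Data.Integer.Tactic.RingSolver using (solve-∀)
open import Data.List using ([]; _∷_)
open import Data.Maybe using (Maybe; just; nothing)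
open import Data.Nat as ℕ using (ℕ; zero; suc)
import Data.Nat.Properties as ℕ
open import Data.Product using (∃; _,_)
open import Data.Rational hiding (_≟_)
open import Data.Rational.Properties
open import Data.Rational.Unnormalised as ℚᵘ using (mkℚᵘ)
import Data.Rational.Unnormalised.Properties as ℚᵘ
open import Relation.Nullary using (Dec; yes; no; contradiction)
open import Relation.Binary.PropositionalEquality

-- The embeddings of ℕ and ℤ in ℚ, and inverses

-- Normalisation blocks evaluation on variable integers, so the homomorphism laws are proved on
-- unnormalised fractions with denominator 1 and carried back.
ℤ→ℚ-homo-+ : ∀ a b → ℤ→ℚ (a ℤ.+ b) ≡ ℤ→ℚ a + ℤ→ℚ b
ℤ→ℚ-homo-+ a b = toℚᵘ-injective (ℚᵘ.≃-trans (toℚᵘ-fromℚᵘ (mkℚᵘ (a ℤ.+ b) 0))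
  (ℚᵘ.≃-trans (ℚᵘ.*≡* (lemma a b)) (ℚᵘ.≃-sym (ℚᵘ.≃-trans (toℚᵘ-homo-+ (ℤ→ℚ a) (ℤ→ℚ b))
    (ℚᵘ.+-cong (toℚᵘ-fromℚᵘ (mkℚᵘ a 0)) (toℚᵘ-fromℚᵘ (mkℚᵘ b 0)))))))
  where
  lemma : ∀ a b → (a ℤ.+ b) ℤ.* + 1 ≡ (a ℤ.* + 1 ℤ.+ b ℤ.* + 1) ℤ.* + 1
  lemma = solve-∀

ℤ→ℚ-homo-* : ∀ a b → ℤ→ℚ (a ℤ.* b) ≡ ℤ→ℚ a * ℤ→ℚ b
ℤ→ℚ-homo-* a b = toℚᵘ-injective (ℚᵘ.≃-trans (toℚᵘ-fromℚᵘ (mkℚᵘ (a ℤ.* b) 0))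
  (ℚᵘ.≃-sym (ℚᵘ.≃-trans (toℚᵘ-homo-* (ℤ→ℚ a) (ℤ→ℚ b))
    (ℚᵘ.*-cong (toℚᵘ-fromℚᵘ (mkℚᵘ a 0)) (toℚᵘ-fromℚᵘ (mkℚᵘ b 0))))))

ℤ→ℚ-homo-neg : ∀ a → ℤ→ℚ (ℤ.- a) ≡ - ℤ→ℚ a
ℤ→ℚ-homo-neg a = toℚᵘ-injective (ℚᵘ.≃-trans (toℚᵘ-fromℚᵘ (mkℚᵘ (ℤ.- a) 0))
  (ℚᵘ.≃-sym (ℚᵘ.≃-trans (toℚᵘ-homo‿- (ℤ→ℚ a)) (ℚᵘ.-‿cong (toℚᵘ-fromℚᵘ (mkℚᵘ a 0))))))

ℤ⟶ℚ : CommutativeRing.rawRing ℤ.+-*-commutativeRing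
  -Raw-AlmostCommutative⟶ fromCommutativeRing +-*-commutativeRing
ℤ⟶ℚ = record
  { ⟦_⟧ = ℤ→ℚ ; +-homo = ℤ→ℚ-homo-+ ; *-homo = ℤ→ℚ-homo-*
  ; -‿homo = ℤ→ℚ-homo-neg ; 0-homo = refl ; 1-homo = refl }

ℤ→ℚ-≟ : ∀ a b → Maybe (ℤ→ℚ a ≡ ℤ→ℚ b)
ℤ→ℚ-≟ a b with a ℤ.≟ b
... | yes a≡b = just (cong ℤ→ℚ a≡b)
... | no _ = nothing

-- Integer coefficients keep the normal forms free of gcd computations.
open RingSolver (CommutativeRing.rawRing ℤ.+-*-commutativeRing)
  (fromCommutativeRing +-*-commutativeRing) ℤ⟶ℚ ℤ→ℚ-≟ using (Polynomial; solve; _:=_; _:+_; _:*_; _:-_; :-_; con)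

#_ : ∀ {n} → ℕ → Polynomial n
# m = con (+ m)
infix 9 #_

κ-+ : ∀ m n → κ (m ℕ.+ n) ≡ κ m + κ n
κ-+ m n = ℤ→ℚ-homo-+ (+ m) (+ n)

κ-* : ∀ m n → κ (m ℕ.* n) ≡ κ m * κ n
κ-* m n = trans (cong ℤ→ℚ (ℤ.pos-* m n)) (ℤ→ℚ-homo-* (+ m) (+ n))

κ-suc : ∀ n → κ (suc n) ≡ κ n + 1ℚ
κ-suc n = trans (κ-+ 1 n) (+-comm 1ℚ (κ n))

0≤κ : ∀ n → 0ℚ ≤ κ n
0≤κ n = toℚᵘ-cancel-≤ (ℚᵘ.≤-respʳ-≃ (ℚᵘ.≃-sym (toℚᵘ-fromℚᵘ (mkℚᵘ (+ n) 0)))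
  (ℚᵘ.*≤* (subst₂ ℤ._≤_ refl (sym (ℤ.*-identityʳ (+ n))) (ℤ.+≤+ ℕ.z≤n))))

0<1 : 0ℚ < 1ℚ
0<1 = *<* (ℤ.+<+ (ℕ.s≤s ℕ.z≤n))

+-nonNeg : ∀ {p q} → 0ℚ ≤ p → 0ℚ ≤ q → 0ℚ ≤ p + q
+-nonNeg = +-mono-≤

+-pos : ∀ {p q} → 0ℚ ≤ p → 0ℚ < q → 0ℚ < p + q
+-pos = +-mono-≤-<

0<κ : ∀ n → 0ℚ < κ (suc n)
0<κ n = subst (0ℚ <_) (sym (κ-suc n)) (+-pos (0≤κ n) 0<1)

κ-mono : ∀ {m n} → m ℕ.≤ n → κ m ≤ κ n
κ-mono {m} {n} m≤n = subst₂ _≤_ (+-identityʳ (κ m))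
  (trans (sym (κ-+ m (n ℕ.∸ m))) (cong κ (ℕ.m+[n∸m]≡n m≤n))) (+-monoʳ-≤ (κ m) (0≤κ (n ℕ.∸ m)))

*-monoˡ-≤₀ : ∀ {p q r} → 0ℚ ≤ p → q ≤ r → p * q ≤ p * r
*-monoˡ-≤₀ {p} 0≤p = *-monoˡ-≤-nonNeg p {{nonNegative 0≤p}}

*-nonNeg : ∀ {p q} → 0ℚ ≤ p → 0ℚ ≤ q → 0ℚ ≤ p * q
*-nonNeg {p} {q} 0≤p 0≤q = subst (_≤ p * q) (*-zeroʳ p) (*-monoˡ-≤₀ 0≤p 0≤q)

*-pos : ∀ {p q} → 0ℚ < p → 0ℚ < q → 0ℚ < p * q
*-pos {p} {q} 0<p 0<q = subst (_< p * q) (*-zeroʳ p) (*-monoʳ-<-pos p {{positive 0<p}} 0<q)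

*-mono-≤₀ : ∀ {p q r s} → 0ℚ ≤ p → p ≤ q → 0ℚ ≤ r → r ≤ s → p * r ≤ q * s
*-mono-≤₀ {p} {q} {r} {s} 0≤p p≤q 0≤r r≤s = ≤-trans (*-monoˡ-≤₀ 0≤p r≤s)
  (subst₂ _≤_ (*-comm s p) (*-comm s q) (*-monoˡ-≤₀ (≤-trans 0≤r r≤s) p≤q))

*-cancelˡ-≤₀ : ∀ {p q r} → 0ℚ < p → p * q ≤ p * r → q ≤ r
*-cancelˡ-≤₀ {p} 0<p = *-cancelˡ-≤-pos p {{positive 0<p}}

pos⇒≢0 : ∀ {p} → 0ℚ < p → p ≢ 0ℚ
pos⇒≢0 0<p refl = <-irrefl refl 0<p

p≤p+q : ∀ p {q} → 0ℚ ≤ q → p ≤ p + q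
p≤p+q p {q} 0≤q = subst (_≤ p + q) (+-identityʳ p) (+-monoʳ-≤ p 0≤q)

inv-right : ∀ {q} → q ≢ 0ℚ → q * inv q ≡ 1ℚ
inv-right {q} q≢0 with q ≟ 0ℚ
... | yes q≡0 = contradiction q≡0 q≢0
... | no  q≢0′ = *-inverseʳ q {{≢-nonZero q≢0′}}

*-cancelˡ : ∀ {q r s} → q ≢ 0ℚ → q * r ≡ q * s → r ≡ s
*-cancelˡ {q} {r} {s} q≢0 eq = begin
  r                ≡⟨ expand r ⟩
  inv q * (q * r)  ≡⟨ cong (inv q *_) eq ⟩
  inv q * (q * s)  ≡⟨ expand s ⟨
  s                ∎
  where
  open ≡-Reasoning
  expand : ∀ t → t ≡ inv q * (q * t)
  expand t = trans (sym (*-identityˡ t)) (trans (cong (_* t) (sym (inv-right q≢0)))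
    (solve 3 (λ q i t → q :* i :* t := i :* (q :* t)) refl q (inv q) t))

÷-unique : ∀ {p q r} → q ≢ 0ℚ → q * r ≡ p → p ÷' q ≡ r
÷-unique {p} {q} {r} q≢0 eq = *-cancelˡ q≢0 (trans
  (solve 3 (λ p q i → q :* (p :* i) := q :* i :* p) refl p q (inv q))
  (trans (cong (_* p) (inv-right q≢0)) (trans (*-identityˡ p) (sym eq))))

*-≢0 : ∀ {p q} → p ≢ 0ℚ → q ≢ 0ℚ → p * q ≢ 0ℚ
*-≢0 {p} p≢0 q≢0 eq = q≢0 (*-cancelˡ p≢0 (trans eq (sym (*-zeroʳ p))))

-- For p = 0 both sides vanish because `inv` sends 0 to 0. This spares a case distinction in every
-- product of a weight Λ with a term of c.
square-*-inv : ∀ p {q} → q ≢ 0ℚ → p * p * inv (q * p) ≡ p * inv q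
square-*-inv p {q} q≢0 with p ≟ 0ℚ
... | yes refl = trans (*-zeroˡ (inv (q * 0ℚ))) (sym (*-zeroˡ (inv q)))
... | no p≢0 = ÷-unique (*-≢0 q≢0 p≢0) (trans
  (solve 3 (λ p q i → q :* p :* (p :* i) := q :* i :* (p :* p)) refl p q (inv q))
  (trans (cong (_* (p * p)) (inv-right q≢0)) (*-identityˡ (p * p))))

inv-nonNeg : ∀ {q} → 0ℚ < q → 0ℚ ≤ inv q
inv-nonNeg {q} 0<q = *-cancelˡ-≤₀ 0<q
  (subst₂ _≤_ (sym (*-zeroʳ q)) (sym (inv-right (pos⇒≢0 0<q))) (<⇒≤ 0<1))

inv-antitone : ∀ {p q} → 0ℚ < p → p ≤ q → inv q ≤ inv p
inv-antitone {p} {q} 0<p p≤q = *-cancelˡ-≤₀ 0<q (*-cancelˡ-≤₀ 0<p (subst₂ _≤_ left right p≤q))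
  where
  0<q = <-≤-trans 0<p p≤q
  left : p ≡ p * (q * inv q)
  left = trans (sym (*-identityʳ p)) (cong (p *_) (sym (inv-right (pos⇒≢0 0<q))))
  right : q ≡ p * (q * inv p)
  right = trans (sym (*-identityʳ q)) (trans (cong (q *_) (sym (inv-right (pos⇒≢0 0<p))))
    (solve 3 (λ p q i → q :* (p :* i) := p :* (q :* i)) refl p q (inv p)))

-- The products C(n,k) C(n+k,k) and the weights λ

K : ℕ → ℚ
K k = κ k + 1ℚ

K≢0 : ∀ k → K k ≢ 0ℚ
K≢0 k = pos⇒≢0 (+-pos (0≤κ k) 0<1)

-- u (κ n) k = C(n,k) C(n+k,k); the common factor g keeps the neighbouring values u (x ± 1) (suc k)
-- polynomial multiples of one quantity, so that no division by x - k is ever needed.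
mutual
  u : ℚ → ℕ → ℚ
  u x zero = 1ℚ
  u x (suc k) = g x k * ((x - κ k) * (x + κ k + 1ℚ))

  g : ℚ → ℕ → ℚ
  g x k = u x k * inv (K k * K k)

u≡g : ∀ x k → u x k ≡ g x k * (K k * K k)
u≡g x k = begin
  u x k                                          ≡⟨ *-identityʳ (u x k) ⟨
  u x k * 1ℚ                                     ≡⟨ cong (u x k *_) (inv-right (*-≢0 (K≢0 k) (K≢0 k))) ⟨
  u x k * (K k * K k * inv (K k * K k))          ≡⟨ solve 3 (λ u q i → u :* (q :* i) := u :* i :* q) refl
                                                      (u x k) (K k * K k) (inv (K k * K k)) ⟩
  g x k * (K k * K k) ∎
  where open ≡-Reasoning

mutual
  -- The quotient of C(n+1,k) C(n+1+k,k) by C(n,k) C(n+k,k) is (n+1+k)/(n+1-k); cross-multiplied, it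
  -- also covers k = n+1. The induction runs through `g-shift`, since `u` at `suc k` is built from
  -- `g` at k.
  u-shift : ∀ x k → u (x + 1ℚ) k * (x + 1ℚ - κ k) ≡ u x k * (x + κ k + 1ℚ)
  u-shift x zero = solve 1 (λ x → # 1 :* (x :+ # 1 :- # 0) := # 1 :* (x :+ # 0 :+ # 1)) refl x
  u-shift x (suc k) = begin
    G′ * (r * (x + 1ℚ + κ k + 1ℚ)) * (x + 1ℚ - κ (suc k))  ≡⟨ cong (λ z → G′ * (r * (x + 1ℚ + κ k + 1ℚ)) * (x + 1ℚ - z)) (κ-suc k) ⟩
    G′ * (r * (x + 1ℚ + κ k + 1ℚ)) * (x + 1ℚ - K k)
      ≡⟨ solve 4 (λ x k G r → G :* (r :* (x :+ # 1 :+ k :+ # 1)) :* (x :+ # 1 :- (k :+ # 1))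
           := G :* r :* ((x :- k) :* (x :+ (k :+ # 1) :+ # 1))) refl x (κ k) G′ r ⟩
    G′ * r * ((x - κ k) * (x + K k + 1ℚ))                 ≡⟨ cong (_* ((x - κ k) * (x + K k + 1ℚ))) (g-shift x k) ⟩
    g x k * (x + κ k + 1ℚ) * ((x - κ k) * (x + K k + 1ℚ))
      ≡⟨ solve 4 (λ G p q r → G :* p :* (q :* r) := G :* (q :* p) :* r) refl (g x k) (x + κ k + 1ℚ) (x - κ k) (x + K k + 1ℚ) ⟩
    u x (suc k) * (x + K k + 1ℚ)                          ≡⟨ cong (λ z → u x (suc k) * (x + z + 1ℚ)) (κ-suc k) ⟨
    u x (suc k) * (x + κ (suc k) + 1ℚ) ∎
    where
    open ≡-Reasoning
    G′ = g (x + 1ℚ) k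
    r = x + 1ℚ - κ k

  g-shift : ∀ x k → g (x + 1ℚ) k * (x + 1ℚ - κ k) ≡ g x k * (x + κ k + 1ℚ)
  g-shift x k = begin
    u (x + 1ℚ) k * i * (x + 1ℚ - κ k)  ≡⟨ swap (u (x + 1ℚ) k) i (x + 1ℚ - κ k) ⟩
    u (x + 1ℚ) k * (x + 1ℚ - κ k) * i  ≡⟨ cong (_* i) (u-shift x k) ⟩
    u x k * (x + κ k + 1ℚ) * i         ≡⟨ swap (u x k) (x + κ k + 1ℚ) i ⟩
    u x k * i * (x + κ k + 1ℚ) ∎
    where
    open ≡-Reasoning
    i = inv (K k * K k)
    swap : ∀ p q r → p * q * r ≡ p * r * q
    swap = solve 3 (λ p q r → p :* q :* r := p :* r :* q) refl

-- The factor x + 1 - k that `u (x + 1ℚ) (suc k)` already contains is the one that `g-shift`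
-- absorbs, so nothing has to be divided. `u-down` uses the same relation in the opposite direction.
u-up : ∀ x k → u (x + 1ℚ) (suc k) ≡ g x k * ((x + κ k + 1ℚ) * (x + κ k + κ 2))
u-up x k = begin
  g (x + 1ℚ) k * ((x + 1ℚ - κ k) * (x + 1ℚ + κ k + 1ℚ))
    ≡⟨ solve 4 (λ G q x k → G :* (q :* (x :+ # 1 :+ k :+ # 1)) := G :* q :* (x :+ k :+ # 2))
         refl (g (x + 1ℚ) k) (x + 1ℚ - κ k) x (κ k) ⟩
  g (x + 1ℚ) k * (x + 1ℚ - κ k) * (x + κ k + κ 2)    ≡⟨ cong (_* (x + κ k + κ 2)) (g-shift x k) ⟩
  g x k * (x + κ k + 1ℚ) * (x + κ k + κ 2)           ≡⟨ *-assoc (g x k) (x + κ k + 1ℚ) (x + κ k + κ 2) ⟩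
  g x k * ((x + κ k + 1ℚ) * (x + κ k + κ 2)) ∎
  where open ≡-Reasoning

u-down : ∀ x k → u x (suc k) ≡ g (x + 1ℚ) k * ((x - κ k) * (x + 1ℚ - κ k))
u-down x k = begin
  g x k * ((x - κ k) * (x + κ k + 1ℚ))
    ≡⟨ solve 3 (λ G p q → G :* (p :* q) := G :* q :* p) refl (g x k) (x - κ k) (x + κ k + 1ℚ) ⟩
  g x k * (x + κ k + 1ℚ) * (x - κ k)             ≡⟨ cong (_* (x - κ k)) (g-shift x k) ⟨
  g (x + 1ℚ) k * (x + 1ℚ - κ k) * (x - κ k)
    ≡⟨ solve 3 (λ G p q → G :* q :* p := G :* (p :* q)) refl (g (x + 1ℚ) k) (x - κ k) (x + 1ℚ - κ k) ⟩
  g (x + 1ℚ) k * ((x - κ k) * (x + 1ℚ - κ k)) ∎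
  where open ≡-Reasoning

Λ : ℚ → ℕ → ℚ
Λ x k = u x k * u x k

cube : ℚ → ℚ
cube x = x * x * x

aperyP : ℚ → ℚ
aperyP x = κ 34 * cube x + κ 51 * (x * x) + κ 27 * x + κ 5

-- β x k Λ x k is the antidifference in k of Apéry's recurrence applied to Λ.
β : ℚ → ℚ → ℚ
β x k = κ 4 * (κ 2 * x + 1ℚ) * (k * (κ 2 * k + 1ℚ) - (κ 2 * x + 1ℚ) * (κ 2 * x + 1ℚ))

module _ {n : ℕ} where
  :cube : Polynomial n → Polynomial n
  :cube x = x :* x :* x

  :aperyP : Polynomial n → Polynomial n
  :aperyP x = # 34 :* :cube x :+ # 51 :* (x :* x) :+ # 27 :* x :+ # 5

  :β : Polynomial n → Polynomial n → Polynomial n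
  :β x k = # 4 :* (# 2 :* x :+ # 1) :* (k :* (# 2 :* k :+ # 1) :- (# 2 :* x :+ # 1) :* (# 2 :* x :+ # 1))

  :sq : Polynomial n → Polynomial n
  :sq p = p :* p

  -- With x = y + 1 and g standing for `g x k`, these are `u (x + 1ℚ) (suc k)` for `:g₊`,
  -- `u x (suc k)` for `:g₀`, `u y (suc k)` for `:g₋` and `u x k` for `:gᵤ`.
  :g₀ :g₊ :g₋ :gᵤ : Polynomial n → Polynomial n → Polynomial n → Polynomial n
  :g₊ y k g = g :* ((y :+ # 1 :+ k :+ # 1) :* (y :+ # 1 :+ k :+ # 2))
  :g₀ y k g = g :* ((y :+ # 1 :- k) :* (y :+ # 1 :+ k :+ # 1))
  :g₋ y k g = g :* ((y :- k) :* (y :+ # 1 :- k))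
  :gᵤ y k g = g :* ((k :+ # 1) :* (k :+ # 1))

-- Recurrence for a

-- The Zeilberger certificate `β` for Apéry's recurrence: over the common factor g², the step in k
-- is an identity of polynomials in y and k.
apery-poly : ∀ y k g → let x = y + 1ℚ; p = g * ((x + k + 1ℚ) * (x + k + κ 2)); q = g * ((x - k) * (x + k + 1ℚ))
                           r = g * ((y - k) * (x - k)); U = g * ((k + 1ℚ) * (k + 1ℚ)) in
    cube (x + 1ℚ) * (p * p) - aperyP x * (q * q) + cube x * (r * r)
      ≡ β x (k + 1ℚ) * (q * q) - β x k * (U * U)
apery-poly = solve 3 (λ y k g → let x = y :+ # 1 in
      :cube (x :+ # 1) :* :sq (:g₊ y k g) :- :aperyP x :* :sq (:g₀ y k g) :+ :cube x :* :sq (:g₋ y k g)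
      := :β x (k :+ # 1) :* :sq (:g₀ y k g) :- :β x k :* :sq (:gᵤ y k g)) refl

apery-step : ∀ y k → let x = y + 1ℚ in
  cube (x + 1ℚ) * Λ (x + 1ℚ) (suc k) - aperyP x * Λ x (suc k) + cube x * Λ y (suc k)
    ≡ β x (κ (suc k)) * Λ x (suc k) - β x (κ k) * Λ x k
apery-step y k = core (u-up (y + 1ℚ) k) (u-down y k) (u≡g (y + 1ℚ) k) (κ-suc k)
  where
  x = y + 1ℚ
  G = g x k
  -- With the values generalised to variables, matching their equations with `refl` puts the goal
  -- into the form of `apery-poly`.
  core : ∀ {p r U k′} → p ≡ G * ((x + κ k + 1ℚ) * (x + κ k + κ 2)) → r ≡ G * ((y - κ k) * (x - κ k)) →
    U ≡ G * (K k * K k) → k′ ≡ K k → let q = G * ((x - κ k) * (x + κ k + 1ℚ)) in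
    cube (x + 1ℚ) * (p * p) - aperyP x * (q * q) + cube x * (r * r) ≡ β x k′ * (q * q) - β x (κ k) * (U * U)
  core refl refl refl refl = apery-poly y (κ k) G

-- The three-term shape serves the recurrences of a and of b, and also the evaluation of Σ λ/(n+k).
telescope : ∀ p q r (f h l A : ℕ → ℚ) → p * f 0 - q * h 0 + r * l 0 ≡ A 0 →
  (∀ k → p * f (suc k) - q * h (suc k) + r * l (suc k) ≡ A (suc k) - A k) →
  ∀ L → p * Σ< (suc L) f - q * Σ< (suc L) h + r * Σ< (suc L) l ≡ A L
telescope p q r f h l A base step zero = trans
  (solve 6 (λ p q r f h l → p :* (# 0 :+ f) :- q :* (# 0 :+ h) :+ r :* (# 0 :+ l) := p :* f :- q :* h :+ r :* l)
    refl p q r (f 0) (h 0) (l 0)) base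
telescope p q r f h l A base step (suc L) = begin
  p * (F + f (suc L)) - q * (H + h (suc L)) + r * (S + l (suc L))
    ≡⟨ solve 9 (λ p q r F H S f h l → p :* (F :+ f) :- q :* (H :+ h) :+ r :* (S :+ l)
         := (p :* F :- q :* H :+ r :* S) :+ (p :* f :- q :* h :+ r :* l))
         refl p q r F H S (f (suc L)) (h (suc L)) (l (suc L)) ⟩
  (p * F - q * H + r * S) + (p * f (suc L) - q * h (suc L) + r * l (suc L))
    ≡⟨ cong₂ _+_ (telescope p q r f h l A base step L) (step L) ⟩
  A L + (A (suc L) - A L)
    ≡⟨ solve 2 (λ a b → a :+ (b :- a) := b) refl (A L) (A (suc L)) ⟩
  A (suc L) ∎
  where
  open ≡-Reasoning
  F = Σ< (suc L) f
  H = Σ< (suc L) h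
  S = Σ< (suc L) l

-- Brings rows of different length to the common upper limit that a three-row recurrence needs.
Σ-stable : ∀ {f : ℕ → ℚ} {m} → (∀ k → m ℕ.≤ k → f k ≡ 0ℚ) → ∀ d → Σ< (d ℕ.+ m) f ≡ Σ< m f
Σ-stable f≡0 zero = refl
Σ-stable {f} {m} f≡0 (suc d) = trans
  (cong₂ _+_ (Σ-stable f≡0 d) (f≡0 (d ℕ.+ m) (ℕ.m≤n+m m d))) (+-identityʳ (Σ< m f))

-- The factor x - k is zero at x = n, k = n, and every later value of `u` retains it.
u-vanish : ∀ n d → u (κ n) (d ℕ.+ suc n) ≡ 0ℚ
u-vanish n zero = trans (cong (λ z → g (κ n) n * (z * (κ n + κ n + 1ℚ))) (+-inverseʳ (κ n)))
  (solve 2 (λ a b → a :* (# 0 :* b) := # 0) refl (g (κ n) n) (κ n + κ n + 1ℚ))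
u-vanish n (suc d) = trans (cong (λ z → z * inv (K (d ℕ.+ suc n) * K (d ℕ.+ suc n)) * rest) (u-vanish n d))
  (solve 2 (λ a b → # 0 :* a :* b := # 0) refl (inv (K (d ℕ.+ suc n) * K (d ℕ.+ suc n))) rest)
  where rest = (κ n - κ (d ℕ.+ suc n)) * (κ n + κ (d ℕ.+ suc n) + 1ℚ)

u≡0 : ∀ {n k} → n ℕ.< k → u (κ n) k ≡ 0ℚ
u≡0 {n} {k} n<k = trans (cong (u (κ n)) (sym (ℕ.m∸n+n≡m n<k))) (u-vanish n (k ℕ.∸ suc n))

Λ≡0 : ∀ {n k} → n ℕ.< k → Λ (κ n) k ≡ 0ℚ
Λ≡0 n<k = cong (λ z → z * z) (u≡0 n<k)

a : ℕ → ℚ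
a n = Σ< (suc n) (Λ (κ n))

a-stable : ∀ n d → Σ< (d ℕ.+ suc n) (Λ (κ n)) ≡ a n
a-stable n d = Σ-stable (λ k n<k → Λ≡0 n<k) d

-- `κ (suc n)` and `κ n + 1ℚ` are equal only propositionally; passing the rows as variables with
-- equations makes the statement usable at the former and provable at the latter.
Λ-telescope : ∀ n {x₁ x₂} → x₁ ≡ κ n + 1ℚ → x₂ ≡ κ n + 1ℚ + 1ℚ → ∀ L →
    cube (x₁ + 1ℚ) * Σ< (suc L) (Λ x₂) - aperyP x₁ * Σ< (suc L) (Λ x₁) + cube x₁ * Σ< (suc L) (Λ (κ n))
      ≡ β x₁ (κ L) * Λ x₁ L
Λ-telescope n refl refl =
  telescope (cube (x + 1ℚ)) (aperyP x) (cube x) (Λ (x + 1ℚ)) (Λ x) (Λ (κ n)) (λ k → β x (κ k) * Λ x k)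
    -- At k = 0 all weights are 1, and (x+1)³ - P(x) + x³ = -4(2x+1)³ is `β x 0ℚ`.
    (solve 1 (λ x → :cube (x :+ # 1) :* # 1 :- :aperyP x :* # 1 :+ :cube x :* # 1 := :β x (# 0) :* # 1) refl x)
    (apery-step (κ n))
  where x = κ n + 1ℚ

κ-suc² : ∀ n → κ (suc (suc n)) ≡ κ n + 1ℚ + 1ℚ
κ-suc² n = trans (κ-suc (suc n)) (cong (_+ 1ℚ) (κ-suc n))

a-recurrence : ∀ n → let x = κ (suc n) in
  cube (x + 1ℚ) * a (suc (suc n)) - aperyP x * a (suc n) + cube x * a n ≡ 0ℚ
a-recurrence n = subst₂ (λ p q → cube (x + 1ℚ) * a (suc (suc n)) - aperyP x * p + cube x * q ≡ 0ℚ)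
  (a-stable (suc n) 1) (a-stable n 2)
  -- The limit n+2 is the end of the longest row and one past the end of row n+1, so the boundary
  -- term contains Λ_{n+1,n+2} = 0.
  (trans (Λ-telescope n (κ-suc n) (κ-suc² n) (suc (suc n)))
    (trans (cong (β x (κ (suc (suc n))) *_) (Λ≡0 {suc n} ℕ.≤-refl)) (*-zeroʳ (β x (κ (suc (suc n)))))))
  where x = κ (suc n)

-- Variation of c in n

sgn : ℕ → ℚ
sgn = powℚ (- 1ℚ)

-- The term m = k+1 of the alternating sum in c_{n,k}.
d : ℚ → ℕ → ℚ
d x k = sgn k * inv (κ 2 * cube (K k) * u x (suc k))

-- δ (κ n) k = c_{n+1,k} - c_{n,k}.
δ : ℚ → ℕ → ℚ
δ x k = inv (cube (x + 1ℚ)) + Σ< k (d (x + 1ℚ)) - Σ< k (d x)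

2K³≢0 : ∀ k → κ 2 * cube (K k) ≢ 0ℚ
2K³≢0 k = *-≢0 (pos⇒≢0 (0<κ 1)) (*-≢0 (*-≢0 (K≢0 k) (K≢0 k)) (K≢0 k))

≢0-factorˡ : ∀ {p q} → p * q ≢ 0ℚ → p ≢ 0ℚ
≢0-factorˡ {p} {q} pq≢0 refl = pq≢0 (*-zeroˡ q)

≢0-factorʳ : ∀ {p q} → p * q ≢ 0ℚ → q ≢ 0ℚ
≢0-factorʳ {p} {q} pq≢0 refl = pq≢0 (*-zeroʳ p)

-- e₊ and e stand for inverses. The right side isolates three blocks of known value: the induction
-- hypothesis s and twice a number times its inverse. `δ-poly₂` is what remains after inserting
-- these values.
δ-poly₁ : ∀ x k g D s e₊ e → let K = k + 1ℚ in
  κ 2 * cube K * ((x + 1ℚ) * (x + 1ℚ) * (x + K + 1ℚ) * (g * ((x - k) * (x + k + 1ℚ)) * (D + (s * e₊ - s * e))))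
  ≡ κ 2 * K * (x - k) * (x + k + κ 2) * ((x + 1ℚ) * (x + 1ℚ) * (x + k + 1ℚ) * (g * (K * K) * D))
    + (x + 1ℚ) * (x + 1ℚ) * (x - k) * s * (κ 2 * cube K * (g * ((x + k + 1ℚ) * (x + k + κ 2))) * e₊)
    - (x + 1ℚ) * (x + 1ℚ) * (x + k + κ 2) * s * (κ 2 * cube K * (g * ((x - k) * (x + k + 1ℚ))) * e)
δ-poly₁ = solve 7 (λ x k g D s e₊ e → let K = k :+ # 1 in
  # 2 :* :cube K :* ((x :+ # 1) :* (x :+ # 1) :* (x :+ K :+ # 1) :* (g :* ((x :- k) :* (x :+ k :+ # 1)) :* (D :+ (s :* e₊ :- s :* e))))
  := # 2 :* K :* (x :- k) :* (x :+ k :+ # 2) :* ((x :+ # 1) :* (x :+ # 1) :* (x :+ k :+ # 1) :* (g :* (K :* K) :* D))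
    :+ (x :+ # 1) :* (x :+ # 1) :* (x :- k) :* s :* (# 2 :* :cube K :* (g :* ((x :+ k :+ # 1) :* (x :+ k :+ # 2))) :* e₊)
    :- (x :+ # 1) :* (x :+ # 1) :* (x :+ k :+ # 2) :* s :* (# 2 :* :cube K :* (g :* ((x :- k) :* (x :+ k :+ # 1))) :* e)) refl

δ-poly₂ : ∀ x k s → let K = k + 1ℚ in
  κ 2 * K * (x - k) * (x + k + κ 2) * s + (x + 1ℚ) * (x + 1ℚ) * (x - k) * s * 1ℚ
    - (x + 1ℚ) * (x + 1ℚ) * (x + k + κ 2) * s * 1ℚ
  ≡ κ 2 * cube K * (s * - 1ℚ)
δ-poly₂ = solve 3 (λ x k s → let K = k :+ # 1 in
  # 2 :* K :* (x :- k) :* (x :+ k :+ # 2) :* s :+ (x :+ # 1) :* (x :+ # 1) :* (x :- k) :* s :* # 1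
    :- (x :+ # 1) :* (x :+ # 1) :* (x :+ k :+ # 2) :* s :* # 1
  := # 2 :* :cube K :* (s :* :- # 1)) refl

δ-suc : ∀ x k → δ x (suc k) ≡ δ x k + (d (x + 1ℚ) k - d x k)
δ-suc x k = solve 5 (λ i S T p q → i :+ (S :+ p) :- (T :+ q) := i :+ S :- T :+ (p :- q)) refl
  (inv (cube (x + 1ℚ))) (Σ< k (d (x + 1ℚ))) (Σ< k (d x)) (d (x + 1ℚ) k) (d x k)

-- Apéry's closed form c_{n+1,k} - c_{n,k} = (-1)^k k!² (n-k)! / ((n+1)² (n+k+1)!), cleared of
-- denominators. It collapses a difference of two sums over k to one term, which is what makes the
-- recurrence for b a polynomial matter.
δ-formula : ∀ {x} → 0ℚ ≤ x → ∀ k → u x k ≢ 0ℚ →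
  (x + 1ℚ) * (x + 1ℚ) * (x + κ k + 1ℚ) * (u x k * δ x k) ≡ sgn k
δ-formula {x} 0≤x zero _ = trans
  (solve 2 (λ x i → (x :+ # 1) :* (x :+ # 1) :* (x :+ # 0 :+ # 1) :* (# 1 :* (i :+ # 0 :- # 0))
     := :cube (x :+ # 1) :* i) refl x (inv (cube (x + 1ℚ))))
  (inv-right (*-≢0 (*-≢0 x+1≢0 x+1≢0) x+1≢0))
  where
  x+1≢0 : x + 1ℚ ≢ 0ℚ
  x+1≢0 = pos⇒≢0 (+-pos 0≤x 0<1)
δ-formula {x} 0≤x (suc k) u′≢0 = *-cancelˡ (2K³≢0 k) (begin
  κ 2 * cube (K k) * ((x + 1ℚ) * (x + 1ℚ) * (x + κ (suc k) + 1ℚ) * (u x (suc k) * δ x (suc k)))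
    ≡⟨ cong₂ (λ k′ D → κ 2 * cube (K k) * ((x + 1ℚ) * (x + 1ℚ) * (x + k′ + 1ℚ) * (u x (suc k) * D)))
         (κ-suc k) (δ-suc x k) ⟩
  κ 2 * cube (K k) * ((x + 1ℚ) * (x + 1ℚ) * (x + K k + 1ℚ) * (u x (suc k) * (δ x k + (s * e₊ - s * e))))
    ≡⟨ δ-poly₁ x (κ k) (g x k) (δ x k) s e₊ e ⟩
  _ ≡⟨ cong₂ _-_ (cong₂ _+_ (cong (κ 2 * K k * (x - κ k) * (x + κ k + κ 2) *_) hypothesis)
         (cong ((x + 1ℚ) * (x + 1ℚ) * (x - κ k) * s *_) e₊-inverse))
         (cong ((x + 1ℚ) * (x + 1ℚ) * (x + κ k + κ 2) * s *_) e-inverse) ⟩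
  _ ≡⟨ δ-poly₂ x (κ k) s ⟩
  κ 2 * cube (K k) * sgn (suc k) ∎)
  where
  open ≡-Reasoning
  s = sgn k
  e = inv (κ 2 * cube (K k) * u x (suc k))
  e₊ = inv (κ 2 * cube (K k) * u (x + 1ℚ) (suc k))
  g≢0 : g x k ≢ 0ℚ
  g≢0 = ≢0-factorˡ u′≢0
  0<x+k+1 : 0ℚ < x + κ k + 1ℚ
  0<x+k+1 = +-pos (+-nonNeg 0≤x (0≤κ k)) 0<1
  u₊≢0 : u (x + 1ℚ) (suc k) ≢ 0ℚ
  u₊≢0 = subst (_≢ 0ℚ) (sym (u-up x k))
    (*-≢0 g≢0 (*-≢0 (pos⇒≢0 0<x+k+1) (pos⇒≢0 (+-pos (+-nonNeg 0≤x (0≤κ k)) (0<κ 1)))))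
  hypothesis : (x + 1ℚ) * (x + 1ℚ) * (x + κ k + 1ℚ) * (g x k * (K k * K k) * δ x k) ≡ s
  hypothesis = trans (cong (λ U → (x + 1ℚ) * (x + 1ℚ) * (x + κ k + 1ℚ) * (U * δ x k)) (sym (u≡g x k)))
    (δ-formula 0≤x k (≢0-factorˡ g≢0))
  e-inverse : κ 2 * cube (K k) * u x (suc k) * e ≡ 1ℚ
  e-inverse = inv-right (*-≢0 (2K³≢0 k) u′≢0)
  e₊-inverse : κ 2 * cube (K k) * (g x k * ((x + κ k + 1ℚ) * (x + κ k + κ 2))) * e₊ ≡ 1ℚ
  e₊-inverse = trans (cong (λ U → κ 2 * cube (K k) * U * e₊) (sym (u-up x k)))
    (inv-right (*-≢0 (2K³≢0 k) u₊≢0))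

-- Recurrence for b and the Casoratian

-- Apéry's c_{n,k} is c (zeta3Partial n) (κ n) k; for k > n it contains inverses of 0, but then Λ (κ n) k = 0.
c : ℚ → ℚ → ℕ → ℚ
c h x k = h + Σ< k (d x)

-- The antidifference of the recurrence applied to Λ c is β Λ c + E.
E : ℚ → ℕ → ℚ
E x k = - (κ 5 * (κ 2 * x + 1ℚ) * (sgn k * κ k) * (u x k * inv (x * (x + 1ℚ))))

-- The part of the step for Λ c that remains after the step for Λ is split off. The first and fourth
-- summands come from the differences of c between rows, the other three on the left from the new
-- term `d` in each row.
b-poly : ∀ y k t s → let x = y + 1ℚ; K = k + 1ℚ in
  (x + 1ℚ) * (κ 2 * t * K * (x * (x + 1ℚ)) * ((x + k + 1ℚ) * ((x + k + κ 2) * (x + k + κ 2))) * s)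
  + cube (x + 1ℚ) * (s * (t * (x * (x + 1ℚ)) * ((x + k + 1ℚ) * (x + k + κ 2))))
  - aperyP x * (s * (t * (x * (x + 1ℚ)) * ((x - k) * (x + k + 1ℚ))))
  - x * (κ 2 * t * K * (x * (x + 1ℚ)) * ((y - k) * (y - k) * (x - k)) * s)
  + cube x * (s * (t * (x * (x + 1ℚ)) * ((y - k) * (x - k))))
  ≡ β x K * (s * (t * (x * (x + 1ℚ)) * ((x - k) * (x + k + 1ℚ))))
    + (- (κ 5 * (κ 2 * x + 1ℚ) * (s * - 1ℚ * K) * (t * (κ 2 * cube K) * ((x - k) * (x + k + 1ℚ))))
       - - (κ 5 * (κ 2 * x + 1ℚ) * (s * k) * (t * (κ 2 * cube K) * (K * K))))
b-poly = solve 4 (λ y k t s → let x = y :+ # 1; K = k :+ # 1 in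
  (x :+ # 1) :* (# 2 :* t :* K :* (x :* (x :+ # 1)) :* ((x :+ k :+ # 1) :* ((x :+ k :+ # 2) :* (x :+ k :+ # 2))) :* s)
  :+ :cube (x :+ # 1) :* (s :* (t :* (x :* (x :+ # 1)) :* ((x :+ k :+ # 1) :* (x :+ k :+ # 2))))
  :- :aperyP x :* (s :* (t :* (x :* (x :+ # 1)) :* ((x :- k) :* (x :+ k :+ # 1))))
  :- x :* (# 2 :* t :* K :* (x :* (x :+ # 1)) :* ((y :- k) :* (y :- k) :* (x :- k)) :* s)
  :+ :cube x :* (s :* (t :* (x :* (x :+ # 1)) :* ((y :- k) :* (x :- k))))
  := :β x K :* (s :* (t :* (x :* (x :+ # 1)) :* ((x :- k) :* (x :+ k :+ # 1))))
    :+ (:- (# 5 :* (# 2 :* x :+ # 1) :* (s :* :- # 1 :* K) :* (t :* (# 2 :* :cube K) :* ((x :- k) :* (x :+ k :+ # 1))))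
       :- :- (# 5 :* (# 2 :* x :+ # 1) :* (s :* k) :* (t :* (# 2 :* :cube K) :* (K :* K))))) refl

-- Measuring all three values of c from the middle one, C, splits the step into C times the step for
-- Λ and a correction free of C. The coefficients of D₊ and D₋ are grouped to match `δ-formula`.
combine : ∀ x P C D₊ D₋ d₊ d₀ d₋ {l₊ l₀ l₋ L β₁ β₀ e₁ e₀ c₊ c₀ c₋} →
  c₊ ≡ C + (D₊ + d₊) → c₀ ≡ C + d₀ → c₋ ≡ C + (d₋ - D₋) →
  cube (x + 1ℚ) * l₊ - P * l₀ + cube x * l₋ ≡ β₁ * l₀ - β₀ * L →
  (x + 1ℚ) * ((x + 1ℚ) * (x + 1ℚ) * (l₊ * D₊)) + cube (x + 1ℚ) * (l₊ * d₊) - P * (l₀ * d₀)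
    - x * (x * x * (l₋ * D₋)) + cube x * (l₋ * d₋) ≡ β₁ * (l₀ * d₀) + (e₁ - e₀) →
  cube (x + 1ℚ) * (l₊ * c₊) - P * (l₀ * c₀) + cube x * (l₋ * c₋)
    ≡ (β₁ * (l₀ * c₀) + e₁) - (β₀ * (L * C) + e₀)
combine x P C D₊ D₋ d₊ d₀ d₋ {l₊} {l₀} {l₋} {L} {β₁} {β₀} {e₁} {e₀} refl refl refl step correction = begin
  cube (x + 1ℚ) * (l₊ * (C + (D₊ + d₊))) - P * (l₀ * (C + d₀)) + cube x * (l₋ * (C + (d₋ - D₋)))
    ≡⟨ solve 11 (λ x P C l₊ l₀ l₋ D₊ D₋ d₊ d₀ d₋ →
      :cube (x :+ # 1) :* (l₊ :* (C :+ (D₊ :+ d₊))) :- P :* (l₀ :* (C :+ d₀)) :+ :cube x :* (l₋ :* (C :+ (d₋ :- D₋)))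
      := C :* (:cube (x :+ # 1) :* l₊ :- P :* l₀ :+ :cube x :* l₋)
        :+ ((x :+ # 1) :* ((x :+ # 1) :* (x :+ # 1) :* (l₊ :* D₊)) :+ :cube (x :+ # 1) :* (l₊ :* d₊) :- P :* (l₀ :* d₀)
           :- x :* (x :* x :* (l₋ :* D₋)) :+ :cube x :* (l₋ :* d₋))) refl x P C l₊ l₀ l₋ D₊ D₋ d₊ d₀ d₋ ⟩
  C * (cube (x + 1ℚ) * l₊ - P * l₀ + cube x * l₋)
    + ((x + 1ℚ) * ((x + 1ℚ) * (x + 1ℚ) * (l₊ * D₊)) + cube (x + 1ℚ) * (l₊ * d₊) - P * (l₀ * d₀)
       - x * (x * x * (l₋ * D₋)) + cube x * (l₋ * d₋))
    ≡⟨ cong₂ (λ p q → C * p + q) step correction ⟩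
  C * (β₁ * l₀ - β₀ * L) + (β₁ * (l₀ * d₀) + (e₁ - e₀))
    ≡⟨ solve 8 (λ C p q l L d e f → C :* (p :* l :- q :* L) :+ (p :* (l :* d) :+ (e :- f))
         := (p :* (l :* (C :+ d)) :+ e) :- (q :* (L :* C) :+ f)) refl C β₁ β₀ l₀ L d₀ e₁ e₀ ⟩
  (β₁ * (l₀ * (C + d₀)) + e₁) - (β₀ * (L * C) + e₀) ∎
  where open ≡-Reasoning

module _ {y : ℚ} (0≤y : 0ℚ ≤ y) (h : ℚ) (k : ℕ) where
  private
    -- t is g divided by every denominator that occurs, which makes the identity b-poly polynomial.
    x G s t D₊ D₋ C : ℚ
    x = y + 1ℚ
    G = g x k
    s = sgn k
    t = G * inv (κ 2 * cube (K k) * (x * (x + 1ℚ)))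
    D₊ = δ x k
    D₋ = δ y k
    C = c (h + inv (cube x)) x k

    0≤x : 0ℚ ≤ x
    0≤x = +-nonNeg 0≤y (<⇒≤ 0<1)

    x≢0 : x ≢ 0ℚ
    x≢0 = pos⇒≢0 (+-pos 0≤y 0<1)

    x[x+1]≢0 : x * (x + 1ℚ) ≢ 0ℚ
    x[x+1]≢0 = *-≢0 x≢0 (pos⇒≢0 (+-pos 0≤x 0<1))

    G≡t : G ≡ t * (κ 2 * cube (K k) * (x * (x + 1ℚ)))
    G≡t = trans (sym (*-identityʳ G)) (trans (cong (G *_) (sym (inv-right (*-≢0 (2K³≢0 k) x[x+1]≢0))))
      (solve 3 (λ G q i → G :* (q :* i) := G :* i :* q) refl G
        (κ 2 * cube (K k) * (x * (x + 1ℚ))) (inv (κ 2 * cube (K k) * (x * (x + 1ℚ))))))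

    Λ*d : ∀ z w → u z (suc k) ≡ G * w → Λ z (suc k) * d z k ≡ s * (t * (x * (x + 1ℚ)) * w)
    Λ*d z w u≡Gw = begin
      Λ z (suc k) * (s * inv (q * u z (suc k)))
        ≡⟨ solve 3 (λ l s i → l :* (s :* i) := s :* (l :* i)) refl (Λ z (suc k)) s (inv (q * u z (suc k))) ⟩
      s * (Λ z (suc k) * inv (q * u z (suc k)))  ≡⟨ cong (s *_) (square-*-inv (u z (suc k)) (2K³≢0 k)) ⟩
      s * (u z (suc k) * inv q)                   ≡⟨ cong (λ v → s * (v * inv q)) (trans u≡Gw (cong (_* w) G≡t)) ⟩
      s * (t * (q * (x * (x + 1ℚ))) * w * inv q)
        ≡⟨ solve 6 (λ s t q r w i → s :* (t :* (q :* r) :* w :* i) := s :* (t :* r :* w) :* (q :* i))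
             refl s t q (x * (x + 1ℚ)) w (inv q) ⟩
      s * (t * (x * (x + 1ℚ)) * w) * (q * inv q)  ≡⟨ cong (s * (t * (x * (x + 1ℚ)) * w) *_) (inv-right (2K³≢0 k)) ⟩
      s * (t * (x * (x + 1ℚ)) * w) * 1ℚ           ≡⟨ *-identityʳ (s * (t * (x * (x + 1ℚ)) * w)) ⟩
      s * (t * (x * (x + 1ℚ)) * w) ∎
      where
      open ≡-Reasoning
      q = κ 2 * cube (K k)

    u*inv : ∀ j w → u x j ≡ G * w → u x j * inv (x * (x + 1ℚ)) ≡ t * (κ 2 * cube (K k)) * w
    u*inv j w u≡Gw = begin
      u x j * inv r                ≡⟨ cong (_* inv r) (trans u≡Gw (cong (_* w) G≡t)) ⟩
      t * (q * r) * w * inv r      ≡⟨ solve 5 (λ t q r w i → t :* (q :* r) :* w :* i := t :* q :* w :* (r :* i))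
                                        refl t q r w (inv r) ⟩
      t * q * w * (r * inv r)      ≡⟨ cong (t * q * w *_) (inv-right x[x+1]≢0) ⟩
      t * q * w * 1ℚ               ≡⟨ *-identityʳ (t * q * w) ⟩
      t * q * w ∎
      where
      open ≡-Reasoning
      q = κ 2 * cube (K k)
      r = x * (x + 1ℚ)

    W₊ W₋ : ℚ
    W₊ = κ 2 * t * K k * (x * (x + 1ℚ)) * ((x + κ k + 1ℚ) * ((x + κ k + κ 2) * (x + κ k + κ 2))) * s
    W₋ = κ 2 * t * K k * (x * (x + 1ℚ)) * ((y - κ k) * (y - κ k) * (x - κ k)) * s

    Λ₊*δ : (x + 1ℚ) * (x + 1ℚ) * (Λ (x + 1ℚ) (suc k) * D₊) ≡ W₊
    Λ₊*δ = by-cases (u x k ≟ 0ℚ)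
      where
      by-cases : Dec (u x k ≡ 0ℚ) → (x + 1ℚ) * (x + 1ℚ) * (Λ (x + 1ℚ) (suc k) * D₊) ≡ W₊
      by-cases (yes u≡0) = trans
              (trans (cong (λ v → (x + 1ℚ) * (x + 1ℚ) * (v * v * D₊)) (trans (u-up x k) (cong (_* r) G≡0)))
                (solve 3 (λ z r D → z :* z :* (# 0 :* r :* (# 0 :* r) :* D) := # 0) refl (x + 1ℚ) r D₊))
              (sym (trans (cong (λ v → κ 2 * (v * i) * K k * (x * (x + 1ℚ)) * r′ * s) G≡0)
                (solve 5 (λ i K z r s → # 2 :* (# 0 :* i) :* K :* z :* r :* s := # 0) refl i (K k) (x * (x + 1ℚ)) r′ s)))
          where
          r = (x + κ k + 1ℚ) * (x + κ k + κ 2)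
          r′ = (x + κ k + 1ℚ) * ((x + κ k + κ 2) * (x + κ k + κ 2))
          i = inv (κ 2 * cube (K k) * (x * (x + 1ℚ)))
          G≡0 : G ≡ 0ℚ
          G≡0 = trans (cong (_* inv (K k * K k)) u≡0) (*-zeroˡ (inv (K k * K k)))
      by-cases (no u≢0) = begin
          (x + 1ℚ) * (x + 1ℚ) * (Λ (x + 1ℚ) (suc k) * D₊)
            ≡⟨ cong₂ (λ v w → (x + 1ℚ) * (x + 1ℚ) * (v * w * D₊)) (u-up x k)
                 (trans (u-up x k) (cong (_* ((x + κ k + 1ℚ) * (x + κ k + κ 2))) G≡t)) ⟩
          _ ≡⟨ solve 5 (λ x k g t D → let K = k :+ # 1; r = (x :+ k :+ # 1) :* (x :+ k :+ # 2) in
                 (x :+ # 1) :* (x :+ # 1) :* (g :* r :* (t :* (# 2 :* :cube K :* (x :* (x :+ # 1))) :* r) :* D)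
                 := # 2 :* t :* K :* (x :* (x :+ # 1)) :* ((x :+ k :+ # 1) :* ((x :+ k :+ # 2) :* (x :+ k :+ # 2)))
                   :* ((x :+ # 1) :* (x :+ # 1) :* (x :+ k :+ # 1) :* (g :* (K :* K) :* D)))
                 refl x (κ k) G t D₊ ⟩
          κ 2 * t * K k * (x * (x + 1ℚ)) * r′ * ((x + 1ℚ) * (x + 1ℚ) * (x + κ k + 1ℚ) * (G * (K k * K k) * D₊))
            ≡⟨ cong (λ v → κ 2 * t * K k * (x * (x + 1ℚ)) * r′ * ((x + 1ℚ) * (x + 1ℚ) * (x + κ k + 1ℚ) * (v * D₊)))
                 (sym (u≡g x k)) ⟩
          κ 2 * t * K k * (x * (x + 1ℚ)) * r′ * ((x + 1ℚ) * (x + 1ℚ) * (x + κ k + 1ℚ) * (u x k * D₊))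
            ≡⟨ cong (κ 2 * t * K k * (x * (x + 1ℚ)) * r′ *_) (δ-formula 0≤x k u≢0) ⟩
          W₊ ∎
          where
          open ≡-Reasoning
          r′ = (x + κ k + 1ℚ) * ((x + κ k + κ 2) * (x + κ k + κ 2))

    -- The factor K² completes K to K³, so that t and its denominator reassemble into G.
    W₋-scaled : K k * K k * W₋ ≡ u y (suc k) * ((y - κ k) * s)
    W₋-scaled = trans
      (solve 4 (λ y k t s → let x = y :+ # 1; K = k :+ # 1 in
        K :* K :* (# 2 :* t :* K :* (x :* (x :+ # 1)) :* ((y :- k) :* (y :- k) :* (x :- k)) :* s)
        := t :* (# 2 :* :cube K :* (x :* (x :+ # 1))) :* ((y :- k) :* (x :- k)) :* ((y :- k) :* s)) refl y (κ k) t s)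
      (cong (_* ((y - κ k) * s)) (sym (trans (u-down y k) (cong (_* ((y - κ k) * (x - κ k))) G≡t))))

    -- One factor `u y (suc k)` is matched by `W₋-scaled`; the other is expanded around y, where K²
    -- turns `g y k` into `u y k` and `δ-formula` applies. If u y k = 0, then u y (suc k) = 0, and
    -- `W₋-scaled` forces W₋ to vanish as well.
    Λ₋*δ : x * x * (Λ y (suc k) * D₋) ≡ W₋
    Λ₋*δ = by-cases (u y k ≟ 0ℚ)
      where
      by-cases : Dec (u y k ≡ 0ℚ) → x * x * (Λ y (suc k) * D₋) ≡ W₋
      by-cases (yes u≡0) = *-cancelˡ (*-≢0 (K≢0 k) (K≢0 k)) (trans
              (trans (cong (λ v → K k * K k * (x * x * (v * v * D₋))) u₋≡0)
                (solve 3 (λ K x D → K :* K :* (x :* x :* (# 0 :* # 0 :* D)) := # 0) refl (K k) x D₋))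
              (sym (trans W₋-scaled (trans (cong (_* ((y - κ k) * s)) u₋≡0) (*-zeroˡ ((y - κ k) * s))))))
          where
          r = (y - κ k) * (y + κ k + 1ℚ)
          u₋≡0 : u y (suc k) ≡ 0ℚ
          u₋≡0 = trans (cong (λ v → v * inv (K k * K k) * r) u≡0)
            (solve 2 (λ i r → # 0 :* i :* r := # 0) refl (inv (K k * K k)) r)
      by-cases (no u≢0) = *-cancelˡ (*-≢0 (K≢0 k) (K≢0 k)) (begin
          K k * K k * (x * x * (u₋ * (g y k * ((y - κ k) * (y + κ k + 1ℚ))) * D₋))
            ≡⟨ solve 6 (λ y k g D x v → let K = k :+ # 1 in
                 K :* K :* (x :* x :* (v :* (g :* ((y :- k) :* (y :+ k :+ # 1))) :* D))
                 := v :* ((y :- k) :* (x :* x :* (y :+ k :+ # 1) :* (g :* (K :* K) :* D)))) refl y (κ k) (g y k) D₋ x u₋ ⟩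
          u₋ * ((y - κ k) * (x * x * (y + κ k + 1ℚ) * (g y k * (K k * K k) * D₋)))
            ≡⟨ cong (λ v → u₋ * ((y - κ k) * (x * x * (y + κ k + 1ℚ) * (v * D₋)))) (sym (u≡g y k)) ⟩
          u₋ * ((y - κ k) * (x * x * (y + κ k + 1ℚ) * (u y k * D₋)))
            ≡⟨ cong (λ v → u₋ * ((y - κ k) * v)) (δ-formula 0≤y k u≢0) ⟩
          u₋ * ((y - κ k) * s)  ≡⟨ W₋-scaled ⟨
          K k * K k * W₋ ∎)
          where
          open ≡-Reasoning
          u₋ = u y (suc k)

    c₊ : c (h + inv (cube x) + inv (cube (x + 1ℚ))) (x + 1ℚ) (suc k) ≡ C + (D₊ + d (x + 1ℚ) k)
    c₊ = solve 6 (λ h i j S T p → h :+ i :+ j :+ (S :+ p) := h :+ i :+ T :+ ((j :+ S :- T) :+ p)) refl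
      h (inv (cube x)) (inv (cube (x + 1ℚ))) (Σ< k (d (x + 1ℚ))) (Σ< k (d x)) (d (x + 1ℚ) k)

    c₀ : c (h + inv (cube x)) x (suc k) ≡ C + d x k
    c₀ = sym (+-assoc (h + inv (cube x)) (Σ< k (d x)) (d x k))

    c₋ : c h y (suc k) ≡ C + (d y k - D₋)
    c₋ = solve 5 (λ h i S T p → h :+ (T :+ p) := h :+ i :+ S :+ (p :- (i :+ S :- T))) refl
      h (inv (cube x)) (Σ< k (d x)) (Σ< k (d y)) (d y k)

    E₀ : E x k ≡ - (κ 5 * (κ 2 * x + 1ℚ) * (s * κ k) * (t * (κ 2 * cube (K k)) * (K k * K k)))
    E₀ = cong (λ v → - (κ 5 * (κ 2 * x + 1ℚ) * (s * κ k) * v)) (u*inv k (K k * K k) (u≡g x k))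

    E₊ : E x (suc k) ≡ - (κ 5 * (κ 2 * x + 1ℚ) * (s * - 1ℚ * K k)
                            * (t * (κ 2 * cube (K k)) * ((x - κ k) * (x + κ k + 1ℚ))))
    E₊ = cong₂ (λ k′ v → - (κ 5 * (κ 2 * x + 1ℚ) * (s * - 1ℚ * k′) * v)) (κ-suc k)
      (u*inv (suc k) ((x - κ k) * (x + κ k + 1ℚ)) refl)

    Λ₀*d : Λ x (suc k) * d x k ≡ s * (t * (x * (x + 1ℚ)) * ((x - κ k) * (x + κ k + 1ℚ)))
    Λ₀*d = Λ*d x ((x - κ k) * (x + κ k + 1ℚ)) refl

    correction :
      (x + 1ℚ) * ((x + 1ℚ) * (x + 1ℚ) * (Λ (x + 1ℚ) (suc k) * D₊))
        + cube (x + 1ℚ) * (Λ (x + 1ℚ) (suc k) * d (x + 1ℚ) k) - aperyP x * (Λ x (suc k) * d x k)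
        - x * (x * x * (Λ y (suc k) * D₋)) + cube x * (Λ y (suc k) * d y k)
      ≡ β x (κ (suc k)) * (Λ x (suc k) * d x k) + (E x (suc k) - E x k)
    correction = core Λ₊*δ (Λ*d (x + 1ℚ) ((x + κ k + 1ℚ) * (x + κ k + κ 2)) (u-up x k)) Λ₀*d Λ₋*δ
        (Λ*d y ((y - κ k) * (x - κ k)) (u-down y k)) (κ-suc k) E₊ E₀
      where
      core : ∀ {p₁ p₂ p₃ p₄ p₅ k′ e₁ e₀} → p₁ ≡ W₊ →
        p₂ ≡ s * (t * (x * (x + 1ℚ)) * ((x + κ k + 1ℚ) * (x + κ k + κ 2))) →
        p₃ ≡ s * (t * (x * (x + 1ℚ)) * ((x - κ k) * (x + κ k + 1ℚ))) → p₄ ≡ W₋ →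
        p₅ ≡ s * (t * (x * (x + 1ℚ)) * ((y - κ k) * (x - κ k))) → k′ ≡ K k →
        e₁ ≡ - (κ 5 * (κ 2 * x + 1ℚ) * (s * - 1ℚ * K k) * (t * (κ 2 * cube (K k)) * ((x - κ k) * (x + κ k + 1ℚ)))) →
        e₀ ≡ - (κ 5 * (κ 2 * x + 1ℚ) * (s * κ k) * (t * (κ 2 * cube (K k)) * (K k * K k))) →
        (x + 1ℚ) * p₁ + cube (x + 1ℚ) * p₂ - aperyP x * p₃ - x * p₄ + cube x * p₅ ≡ β x k′ * p₃ + (e₁ - e₀)
      core refl refl refl refl refl refl refl refl = b-poly y (κ k) t s

  b-step : cube (x + 1ℚ) * (Λ (x + 1ℚ) (suc k) * c (h + inv (cube x) + inv (cube (x + 1ℚ))) (x + 1ℚ) (suc k))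
      - aperyP x * (Λ x (suc k) * c (h + inv (cube x)) x (suc k)) + cube x * (Λ y (suc k) * c h y (suc k))
    ≡ (β x (κ (suc k)) * (Λ x (suc k) * c (h + inv (cube x)) x (suc k)) + E x (suc k))
      - (β x (κ k) * (Λ x k * c (h + inv (cube x)) x k) + E x k)
  b-step = combine x (aperyP x) C D₊ D₋ (d (x + 1ℚ) k) (d x k) (d y k)
    {Λ (x + 1ℚ) (suc k)} {Λ x (suc k)} {Λ y (suc k)} {Λ x k} {β x (κ (suc k))} {β x (κ k)} {E x (suc k)} {E x k}
    c₊ c₀ c₋ (apery-step y k) correction

b : ℕ → ℚ
b n = Σ< (suc n) (λ k → Λ (κ n) k * c (zeta3Partial n) (κ n) k)

b-stable : ∀ n m → Σ< (m ℕ.+ suc n) (λ k → Λ (κ n) k * c (zeta3Partial n) (κ n) k) ≡ b n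
b-stable n = Σ-stable (λ k n<k → trans (cong (_* c (zeta3Partial n) (κ n) k) (Λ≡0 n<k))
  (*-zeroˡ (c (zeta3Partial n) (κ n) k)))

Λc-telescope : ∀ n h {x₁ x₂ h₁ h₂} → x₁ ≡ κ n + 1ℚ → x₂ ≡ κ n + 1ℚ + 1ℚ →
  h₁ ≡ h + inv (cube (κ n + 1ℚ)) → h₂ ≡ h + inv (cube (κ n + 1ℚ)) + inv (cube (κ n + 1ℚ + 1ℚ)) → ∀ L →
  cube (x₁ + 1ℚ) * Σ< (suc L) (λ k → Λ x₂ k * c h₂ x₂ k) - aperyP x₁ * Σ< (suc L) (λ k → Λ x₁ k * c h₁ x₁ k)
    + cube x₁ * Σ< (suc L) (λ k → Λ (κ n) k * c h (κ n) k)
    ≡ β x₁ (κ L) * (Λ x₁ L * c h₁ x₁ L) + E x₁ L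
Λc-telescope n h refl refl refl refl =
  telescope (cube (x + 1ℚ)) (aperyP x) (cube x) (λ k → Λ (x + 1ℚ) k * c (h + i + j) (x + 1ℚ) k)
    (λ k → Λ x k * c (h + i) x k) (λ k → Λ (κ n) k * c h (κ n) k)
    (λ k → β x (κ k) * (Λ x k * c (h + i) x k) + E x k) base (b-step (0≤κ n) h)
  where
  open ≡-Reasoning
  x i j : ℚ
  x = κ n + 1ℚ
  i = inv (cube x)
  j = inv (cube (x + 1ℚ))
  0<x : 0ℚ < x
  0<x = +-pos (0≤κ n) 0<1
  cube-inv : ∀ {z} → 0ℚ < z → cube z * inv (cube z) ≡ 1ℚ
  cube-inv 0<z = inv-right (pos⇒≢0 (*-pos (*-pos 0<z 0<z) 0<z))
  base : cube (x + 1ℚ) * (1ℚ * (h + i + j + 0ℚ)) - aperyP x * (1ℚ * (h + i + 0ℚ)) + cube x * (1ℚ * (h + 0ℚ))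
    ≡ β x 0ℚ * (1ℚ * (h + i + 0ℚ)) + E x 0
  -- Compared with h + i, the upper row gains j and the lower row lacks i; their cubic coefficients
  -- turn this into 1 - 1, so only the identity for Λ is left.
  base = begin
    _ ≡⟨ solve 4 (λ x h i j →
           :cube (x :+ # 1) :* (# 1 :* (h :+ i :+ j :+ # 0)) :- :aperyP x :* (# 1 :* (h :+ i :+ # 0)) :+ :cube x :* (# 1 :* (h :+ # 0))
           := :β x (# 0) :* (# 1 :* (h :+ i :+ # 0)) :+ (:cube (x :+ # 1) :* j :- :cube x :* i)) refl x h i j ⟩
    β x 0ℚ * (1ℚ * (h + i + 0ℚ)) + (cube (x + 1ℚ) * j - cube x * i)
      ≡⟨ cong₂ (λ p q → β x 0ℚ * (1ℚ * (h + i + 0ℚ)) + (p - q)) (cube-inv (+-pos (<⇒≤ 0<x) 0<1)) (cube-inv 0<x) ⟩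
    β x 0ℚ * (1ℚ * (h + i + 0ℚ)) + 0ℚ
      ≡⟨ cong (λ z → β x 0ℚ * (1ℚ * (h + i + 0ℚ)) + z) (solve 2 (λ x r → # 0 :=
           :- (# 5 :* (# 2 :* x :+ # 1) :* (# 1 :* # 0) :* (# 1 :* r))) refl x (inv (x * (x + 1ℚ)))) ⟩
    β x 0ℚ * (1ℚ * (h + i + 0ℚ)) + E x 0 ∎

zeta3-suc : ∀ n {x} → κ (suc n) ≡ x → zeta3Partial (suc n) ≡ zeta3Partial n + inv (cube x)
zeta3-suc n {x} refl = cong (λ z → zeta3Partial n + inv z) (begin
  κ (suc n ℕ.* (suc n ℕ.* (suc n ℕ.* 1)))  ≡⟨ cong (λ m → κ (suc n ℕ.* (suc n ℕ.* m))) (ℕ.*-identityʳ (suc n)) ⟩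
  κ (suc n ℕ.* (suc n ℕ.* suc n))          ≡⟨ κ-* (suc n) (suc n ℕ.* suc n) ⟩
  x * κ (suc n ℕ.* suc n)                  ≡⟨ cong (x *_) (κ-* (suc n) (suc n)) ⟩
  x * (x * x)                              ≡⟨ *-assoc x x x ⟨
  cube x ∎)
  where open ≡-Reasoning

b-recurrence : ∀ n → let x = κ (suc n) in
  cube (x + 1ℚ) * b (suc (suc n)) - aperyP x * b (suc n) + cube x * b n ≡ 0ℚ
b-recurrence n = subst₂ (λ p q → cube (x + 1ℚ) * b (suc (suc n)) - aperyP x * p + cube x * q ≡ 0ℚ)
  (b-stable (suc n) 1) (b-stable n 2)
  (trans (Λc-telescope n (zeta3Partial n) (κ-suc n) (κ-suc² n) h₁≡
      (trans (zeta3-suc (suc n) (κ-suc² n)) (cong (_+ inv (cube (κ n + 1ℚ + 1ℚ))) h₁≡)) (suc (suc n)))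
    (trans (cong (λ z → β x (κ (suc (suc n))) * (z * z * c (zeta3Partial (suc n)) x (suc (suc n)))
             + - (κ 5 * (κ 2 * x + 1ℚ) * (sgn (suc (suc n)) * κ (suc (suc n))) * (z * inv (x * (x + 1ℚ)))))
             (u≡0 {suc n} ℕ.≤-refl))
      (solve 4 (λ p q r i → p :* (# 0 :* # 0 :* q) :+ :- (r :* (# 0 :* i)) := # 0) refl
        (β x (κ (suc (suc n)))) (c (zeta3Partial (suc n)) x (suc (suc n)))
        (κ 5 * (κ 2 * x + 1ℚ) * (sgn (suc (suc n)) * κ (suc (suc n)))) (inv (x * (x + 1ℚ))))))
  where
  x = κ (suc n)
  h₁≡ = zeta3-suc n (κ-suc n)

-- Eliminating the middle row between the two recurrences shows that the left side does not depend
-- on n. The value 6 comes from a₀ = 1, a₁ = 5, b₀ = 0, b₁ = 6.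
casoratian : ∀ n → cube (κ (suc n)) * (b (suc n) * a n - a (suc n) * b n) ≡ κ 6
casoratian zero = refl
casoratian (suc n) = begin
  cube (κ (suc (suc n))) * (b₂ * a₁ - a₂ * b₁)  ≡⟨ cong (λ z → cube z * (b₂ * a₁ - a₂ * b₁)) (κ-suc (suc n)) ⟩
  cube (x + 1ℚ) * (b₂ * a₁ - a₂ * b₁)
    ≡⟨ solve 8 (λ x P a₀ a₁ a₂ b₀ b₁ b₂ → :cube (x :+ # 1) :* (b₂ :* a₁ :- a₂ :* b₁)
         := (:cube (x :+ # 1) :* b₂ :- P :* b₁ :+ :cube x :* b₀) :* a₁
            :- (:cube (x :+ # 1) :* a₂ :- P :* a₁ :+ :cube x :* a₀) :* b₁
            :+ :cube x :* (b₁ :* a₀ :- a₁ :* b₀)) refl x (aperyP x) (a n) a₁ a₂ (b n) b₁ b₂ ⟩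
  _ ≡⟨ cong₂ _+_ (cong₂ (λ p q → p * a₁ - q * b₁) (b-recurrence n) (a-recurrence n)) (casoratian n) ⟩
  0ℚ * a₁ - 0ℚ * b₁ + κ 6
    ≡⟨ solve 2 (λ p q → # 0 :* p :- # 0 :* q :+ # 6 := # 6) refl a₁ b₁ ⟩
  κ 6 ∎
  where
  open ≡-Reasoning
  x = κ (suc n)
  a₁ = a (suc n)
  a₂ = a (suc (suc n))
  b₁ = b (suc n)
  b₂ = b (suc (suc n))

-- Θ in terms of a

τ : ℚ → ℕ → ℚ
τ x k = Λ x k * inv (x + κ k)

-- The antidifference is 4 (1 - k/x)² Λ, multiplied by x² to clear denominators. Division by x + k +
-- 1 is harmless, because this is already a factor of `u x (suc k)`.
τ-poly : ∀ y k g → let x = y + 1ℚ; K = k + 1ℚ; q = g * ((x - k) * (x + k + 1ℚ))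
                       r = g * ((y - k) * (x - k)); U = g * (K * K) in
  κ 12 * cube x * (g * g * ((x - k) * (x - k)) * (x + K)) - κ 7 * (x * x) * (q * q) + - (x * x) * (r * r)
    ≡ κ 4 * (q * q * ((x - K) * (x - K))) - κ 4 * (U * U * ((x - k) * (x - k)))
τ-poly = solve 3 (λ y k g → let x = y :+ # 1; K = k :+ # 1 in
  # 12 :* :cube x :* (g :* g :* ((x :- k) :* (x :- k)) :* (x :+ K)) :- # 7 :* (x :* x) :* :sq (:g₀ y k g) :+ :- (x :* x) :* :sq (:g₋ y k g)
    := # 4 :* (:sq (:g₀ y k g) :* ((x :- K) :* (x :- K))) :- # 4 :* (:sq (:gᵤ y k g) :* ((x :- k) :* (x :- k)))) refl

τ-step : ∀ {y} → 0ℚ ≤ y → ∀ k → let x = y + 1ℚ in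
  κ 12 * cube x * τ x (suc k) - κ 7 * (x * x) * Λ x (suc k) + - (x * x) * Λ y (suc k)
    ≡ κ 4 * (Λ x (suc k) * ((x - κ (suc k)) * (x - κ (suc k)))) - κ 4 * (Λ x k * ((x - κ k) * (x - κ k)))
τ-step {y} 0≤y k = core τ≡ (u-down y k) (u≡g x k) (κ-suc k)
  where
  x G : ℚ
  x = y + 1ℚ
  G = g x k
  τ≡ : τ x (suc k) ≡ G * G * ((x - κ k) * (x - κ k)) * (x + K k)
  τ≡ = trans (cong (λ z → Λ x (suc k) * inv (x + z)) (κ-suc k))
    (÷-unique (pos⇒≢0 (+-pos (+-nonNeg 0≤y (<⇒≤ 0<1)) (+-pos (0≤κ k) 0<1)))
      (solve 3 (λ x k g → let K = k :+ # 1 in (x :+ K) :* (g :* g :* ((x :- k) :* (x :- k)) :* (x :+ K))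
         := :sq (g :* ((x :- k) :* (x :+ k :+ # 1)))) refl x (κ k) G))
  core : ∀ {t r U k′} → t ≡ G * G * ((x - κ k) * (x - κ k)) * (x + K k) → r ≡ G * ((y - κ k) * (x - κ k)) →
    U ≡ G * (K k * K k) → k′ ≡ K k → let q = G * ((x - κ k) * (x + κ k + 1ℚ)) in
    κ 12 * cube x * t - κ 7 * (x * x) * (q * q) + - (x * x) * (r * r)
      ≡ κ 4 * (q * q * ((x - k′) * (x - k′))) - κ 4 * (U * U * ((x - κ k) * (x - κ k)))
  core refl refl refl refl = τ-poly y (κ k) G

τ-telescope : ∀ n {x} → x ≡ κ n + 1ℚ → ∀ L →
  κ 12 * cube x * Σ< (suc L) (τ x) - κ 7 * (x * x) * Σ< (suc L) (Λ x) + - (x * x) * Σ< (suc L) (Λ (κ n))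
    ≡ κ 4 * (Λ x L * ((x - κ L) * (x - κ L)))
τ-telescope n refl = telescope (κ 12 * cube x) (κ 7 * (x * x)) (- (x * x)) (τ x) (Λ x) (Λ (κ n))
  (λ k → κ 4 * (Λ x k * ((x - κ k) * (x - κ k)))) base (τ-step (0≤κ n))
  where
  x : ℚ
  x = κ n + 1ℚ
  base : κ 12 * cube x * (1ℚ * inv (x + 0ℚ)) - κ 7 * (x * x) * 1ℚ + - (x * x) * 1ℚ ≡ κ 4 * (1ℚ * ((x - 0ℚ) * (x - 0ℚ)))
  base = trans
    (solve 2 (λ x i → # 12 :* :cube x :* (# 1 :* i) :- # 7 :* (x :* x) :* # 1 :+ :- (x :* x) :* # 1
       := # 12 :* (x :* x) :* ((x :+ # 0) :* i) :- # 8 :* (x :* x)) refl x (inv (x + 0ℚ)))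
    (trans (cong (λ z → κ 12 * (x * x) * z - κ 8 * (x * x))
        (inv-right (subst (_≢ 0ℚ) (sym (+-identityʳ x)) (pos⇒≢0 (+-pos (0≤κ n) 0<1)))))
      (solve 1 (λ x → # 12 :* (x :* x) :* # 1 :- # 8 :* (x :* x) := # 4 :* (# 1 :* ((x :- # 0) :* (x :- # 0)))) refl x))

T : ℕ → ℚ
T n = Σ< (suc n) (τ (κ n))

T-formula : ∀ n → κ 12 * κ (suc n) * T (suc n) ≡ κ 7 * a (suc n) + a n
T-formula n = *-cancelˡ (*-≢0 x≢0 x≢0) (begin
  x * x * (κ 12 * x * T (suc n))
    ≡⟨ solve 4 (λ x t a a′ → x :* x :* (# 12 :* x :* t)
         := (# 12 :* :cube x :* t :- # 7 :* (x :* x) :* a :+ :- (x :* x) :* a′) :+ x :* x :* (# 7 :* a :+ a′))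
         refl x (T (suc n)) (a (suc n)) A₋ ⟩
  _ ≡⟨ cong₂ (λ p q → p + x * x * (κ 7 * a (suc n) + q)) (τ-telescope n (κ-suc n) (suc n)) (a-stable n 1) ⟩
  -- The boundary term dies through (x - x)²: the limit is L = n+1 = x, where Λ itself is still
  -- nonzero.
  κ 4 * (Λ x (suc n) * ((x - x) * (x - x))) + x * x * (κ 7 * a (suc n) + a n)
    ≡⟨ solve 3 (λ l x r → # 4 :* (l :* ((x :- x) :* (x :- x))) :+ r := r) refl (Λ x (suc n)) x (x * x * (κ 7 * a (suc n) + a n)) ⟩
  x * x * (κ 7 * a (suc n) + a n) ∎)
  where
  open ≡-Reasoning
  x A₋ : ℚ
  x = κ (suc n)
  A₋ = Σ< (suc (suc n)) (Λ (κ n))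
  x≢0 : x ≢ 0ℚ
  x≢0 = pos⇒≢0 (0<κ n)

-- Applied twice to the series of Θ: at r = ρn+1 it produces the numerator r + k, and at x = n it
-- trades (n)_k for a second (n+1)_k over n + k.
poch-shift : ∀ x k → x * poch (x + 1ℚ) k ≡ poch x k * (x + κ k)
poch-shift x zero = solve 1 (λ x → x :* # 1 := # 1 :* (x :+ # 0)) refl x
poch-shift x (suc k) = begin
  x * (poch (x + 1ℚ) k * (x + 1ℚ + κ k))
    ≡⟨ solve 3 (λ x p k → x :* (p :* (x :+ # 1 :+ k)) := x :* p :* (x :+ (k :+ # 1))) refl x (poch (x + 1ℚ) k) (κ k) ⟩
  x * poch (x + 1ℚ) k * (x + K k)   ≡⟨ cong₂ (λ p q → p * (x + q)) (poch-shift x k) (sym (κ-suc k)) ⟩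
  poch x (suc k) * (x + κ (suc k)) ∎
  where open ≡-Reasoning

-- For x = n this is (n+k)!/n! times (-1)^k n!/(n-k)!. The terms of Θ contain the pair squared, so
-- the sign drops out and Λ appears.
poch-pair : ∀ x k → poch (x + 1ℚ) k * poch (- x) k ≡ sgn k * (u x k * (factorial k * factorial k))
poch-pair x zero = refl
poch-pair x (suc k) = begin
  poch (x + 1ℚ) k * (x + 1ℚ + κ k) * (poch (- x) k * (- x + κ k))
    ≡⟨ solve 4 (λ p q x k → p :* (x :+ # 1 :+ k) :* (q :* (:- x :+ k)) := :- (p :* q :* ((x :- k) :* (x :+ k :+ # 1))))
         refl (poch (x + 1ℚ) k) (poch (- x) k) x (κ k) ⟩
  - (poch (x + 1ℚ) k * poch (- x) k * r)       ≡⟨ cong (λ z → - (z * r)) (poch-pair x k) ⟩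
  - (sgn k * (u x k * (f * f)) * r)            ≡⟨ cong (λ z → - (sgn k * (z * (f * f)) * r)) (u≡g x k) ⟩
  - (sgn k * (g x k * (K k * K k) * (f * f)) * r)
    ≡⟨ solve 5 (λ s g K f r → :- (s :* (g :* (K :* K) :* (f :* f)) :* r)
         := s :* :- # 1 :* (g :* r :* (f :* K :* (f :* K)))) refl (sgn k) (g x k) (K k) f r ⟩
  sgn (suc k) * (u x (suc k) * (f * K k * (f * K k)))
    ≡⟨ cong (λ z → sgn (suc k) * (u x (suc k) * (f * z * (f * z)))) (sym (κ-suc k)) ⟩
  sgn (suc k) * (u x (suc k) * (factorial (suc k) * factorial (suc k))) ∎
  where
  open ≡-Reasoning
  f r : ℚ
  f = factorial k
  r = (x - κ k) * (x + κ k + 1ℚ)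

sgn² : ∀ k → sgn k * sgn k ≡ 1ℚ
sgn² zero = refl
sgn² (suc k) = trans (solve 1 (λ s → s :* :- # 1 :* (s :* :- # 1) := s :* s) refl (sgn k)) (sgn² k)

powℚ-1 : ∀ k → powℚ 1ℚ k ≡ 1ℚ
powℚ-1 zero = refl
powℚ-1 (suc k) = trans (*-identityʳ (powℚ 1ℚ k)) (powℚ-1 k)

factorial-pos : ∀ k → 0ℚ < factorial k
factorial-pos zero = 0<1
factorial-pos (suc k) = *-pos (factorial-pos k) (0<κ k)

poch-pos : ∀ {x} → 0ℚ < x → ∀ k → 0ℚ < poch x k
poch-pos 0<x zero = 0<1
poch-pos {x} 0<x (suc k) = *-pos (poch-pos 0<x k)
  (subst (0ℚ <_) (+-comm (κ k) x) (+-pos (0≤κ k) 0<x))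

poch-1 : ∀ k → poch 1ℚ k ≡ factorial k
poch-1 zero = refl
poch-1 (suc k) = cong₂ _*_ (poch-1 k) (trans (+-comm 1ℚ (κ k)) (sym (κ-suc k)))

-- With s = r - x, Λ x k + s τ x k = Λ x k (r + k) / (x + k).
hypTerm-formula : ∀ {x r} → 0ℚ < x → 0ℚ < r → ∀ k →
  r ÷' x * hypTerm ((x + 1ℚ) ∷ x ∷ - x ∷ - x ∷ (r + 1ℚ) ∷ []) (1ℚ ∷ 1ℚ ∷ 1ℚ ∷ r ∷ []) 1ℚ k
    ≡ Λ x k + (r - x) * τ x k
hypTerm-formula {x} {r} 0<x 0<r k = *-cancelˡ (*-≢0 (*-≢0 x≢0 D≢0) x+k≢0) (begin
  x * D * (x + κ k) * (r * inv x * (N * powℚ 1ℚ k * inv D))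
    ≡⟨ cong (λ z → x * D * (x + κ k) * (r * inv x * (N * z * inv D))) (powℚ-1 k) ⟩
  x * D * (x + κ k) * (r * inv x * (N * 1ℚ * inv D))
    ≡⟨ solve 11 (λ x k r p₁ p₀ q t D i j e → x :* D :* (x :+ k) :* (r :* i :* (p₁ :* (p₀ :* (q :* (q :* (t :* e)))) :* e :* j))
         := (x :* i) :* (D :* j) :* (e :* e) :* (r :* t) :* (p₁ :* q :* q) :* (p₀ :* (x :+ k)))
         refl x (κ k) r p₁ p₀ q t D (inv x) (inv D) 1ℚ ⟩
  (x * inv x) * (D * inv D) * (1ℚ * 1ℚ) * (r * t) * (p₁ * q * q) * (p₀ * (x + κ k))
    ≡⟨ cong₂ _*_ (cong₂ (λ y z → y * z * (p₁ * q * q)) (cong₂ (λ y z → y * z * (1ℚ * 1ℚ)) (inv-right x≢0) (inv-right D≢0))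
         (poch-shift r k)) (sym (poch-shift x k)) ⟩
  1ℚ * 1ℚ * (1ℚ * 1ℚ) * (w * (r + κ k)) * (p₁ * q * q) * (x * p₁)
    ≡⟨ solve 6 (λ w r x p q k → # 1 :* # 1 :* (# 1 :* # 1) :* (w :* (r :+ k)) :* (p :* q :* q) :* (x :* p)
         := x :* w :* (r :+ k) :* (p :* q :* (p :* q))) refl w r x p₁ q (κ k) ⟩
  x * w * (r + κ k) * (p₁ * q * (p₁ * q))
    ≡⟨ cong (λ z → x * w * (r + κ k) * (z * z)) (poch-pair x k) ⟩
  x * w * (r + κ k) * (sgn k * (u x k * (f * f)) * (sgn k * (u x k * (f * f))))
    ≡⟨ solve 7 (λ x w r k s v f → x :* w :* (r :+ k) :* (s :* (v :* (f :* f)) :* (s :* (v :* (f :* f))))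
         := (s :* s) :* (x :* (f :* (f :* (f :* (w :* # 1))) :* f) :* (v :* v :* (r :+ k)))) refl x w r (κ k) (sgn k) (u x k) f ⟩
  sgn k * sgn k * (x * (f * (f * (f * (w * 1ℚ))) * f) * (Λ x k * (r + κ k)))
    ≡⟨ cong₂ (λ y z → y * (x * (z * (z * (z * (w * 1ℚ))) * f) * (Λ x k * (r + κ k)))) (sgn² k) (sym (poch-1 k)) ⟩
  1ℚ * (x * D * (Λ x k * (r + κ k)))
    ≡⟨ solve 5 (λ x D l r k → # 1 :* (x :* D :* (l :* (r :+ k))) := x :* D :* (l :* ((x :+ k) :+ (r :- x) :* # 1)))
         refl x D (Λ x k) r (κ k) ⟩
  x * D * (Λ x k * ((x + κ k) + (r - x) * 1ℚ))
    ≡⟨ cong (λ z → x * D * (Λ x k * ((x + κ k) + (r - x) * z))) (sym (inv-right x+k≢0)) ⟩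
  x * D * (Λ x k * ((x + κ k) + (r - x) * ((x + κ k) * inv (x + κ k))))
    ≡⟨ solve 6 (λ x D l z s i → x :* D :* (l :* (z :+ s :* (z :* i))) := x :* D :* z :* (l :+ s :* (l :* i)))
         refl x D (Λ x k) (x + κ k) (r - x) (inv (x + κ k)) ⟩
  x * D * (x + κ k) * (Λ x k + (r - x) * τ x k) ∎)
  where
  open ≡-Reasoning
  p₁ p₀ q t w f N D : ℚ
  p₁ = poch (x + 1ℚ) k
  p₀ = poch x k
  q = poch (- x) k
  t = poch (r + 1ℚ) k
  w = poch r k
  f = factorial k
  N = p₁ * (p₀ * (q * (q * (t * 1ℚ))))
  D = poch 1ℚ k * (poch 1ℚ k * (poch 1ℚ k * (w * 1ℚ))) * f
  x≢0 : x ≢ 0ℚ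
  x≢0 = pos⇒≢0 0<x
  x+k≢0 : x + κ k ≢ 0ℚ
  x+k≢0 = pos⇒≢0 (subst (0ℚ <_) (+-comm (κ k) x) (+-pos (0≤κ k) 0<x))
  D≢0 : D ≢ 0ℚ
  D≢0 = pos⇒≢0 (*-pos (*-pos pos₁ (*-pos pos₁ (*-pos pos₁ (*-pos (poch-pos 0<r k) 0<1)))) (factorial-pos k))
    where pos₁ = poch-pos 0<1 k

Σ-linear : ∀ q s {f h l : ℕ → ℚ} → (∀ k → q * f k ≡ h k + s * l k) → ∀ N → q * Σ< N f ≡ Σ< N h + s * Σ< N l
Σ-linear q s eq zero = solve 2 (λ q s → q :* # 0 := # 0 :+ s :* # 0) refl q s
Σ-linear q s {f} {h} {l} eq (suc N) = begin
  q * (Σ< N f + f N)                              ≡⟨ *-distribˡ-+ q (Σ< N f) (f N) ⟩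
  q * Σ< N f + q * f N                            ≡⟨ cong₂ _+_ (Σ-linear q s eq N) (eq N) ⟩
  (Σ< N h + s * Σ< N l) + (h N + s * l N)
    ≡⟨ solve 5 (λ H L h l s → (H :+ s :* L) :+ (h :+ s :* l) := (H :+ h) :+ s :* (L :+ l)) refl (Σ< N h) (Σ< N l) (h N) (l N) s ⟩
  (Σ< N h + h N) + s * (Σ< N l + l N) ∎
  where open ≡-Reasoning

σ : ℚ → ℚ → ℚ
σ R x = (R - 1ℚ) * x + 1ℚ

Θ-formula : ∀ ρ n → Θ ρ (suc n) ≡ a (suc n) + σ (κ ρ) (κ (suc n)) * T (suc n)
Θ-formula ρ n = trans (core (κ-+ (suc n) 1) (κ-+ (ρ ℕ.* suc n) 1) (trans (κ-+ (ρ ℕ.* suc n) 2)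
    (trans (sym (+-assoc (κ (ρ ℕ.* suc n)) 1ℚ 1ℚ)) (cong (_+ 1ℚ) (sym (κ-+ (ρ ℕ.* suc n) 1))))))
    (cong (λ z → a (suc n) + z * T (suc n)) r-x≡σ)
  where
  x r : ℚ
  x = κ (suc n)
  r = κ (ρ ℕ.* suc n ℕ.+ 1)
  0<r : 0ℚ < r
  0<r = subst (0ℚ <_) (sym (κ-+ (ρ ℕ.* suc n) 1)) (+-pos (0≤κ (ρ ℕ.* suc n)) 0<1)
  -- The parameters in `Θ` are casts of natural sums; identifying them with x + 1 and r + 1 lets
  -- `hypTerm-formula` apply termwise.
  core : ∀ {x₁ r₂} → x₁ ≡ x + 1ℚ → r ≡ κ (ρ ℕ.* suc n) + 1ℚ → r₂ ≡ r + 1ℚ →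
    r ÷' x * hypSum (suc (suc n)) (x₁ ∷ x ∷ - x ∷ - x ∷ r₂ ∷ []) (1ℚ ∷ 1ℚ ∷ 1ℚ ∷ r ∷ []) 1ℚ
      ≡ a (suc n) + (r - x) * T (suc n)
  core refl _ refl = Σ-linear (r ÷' x) (r - x) (hypTerm-formula (0<κ n) 0<r) (suc (suc n))
  r-x≡σ : r - x ≡ σ (κ ρ) x
  r-x≡σ = trans (cong (_- x) (trans (κ-+ (ρ ℕ.* suc n) 1) (cong (_+ 1ℚ) (κ-* ρ (suc n)))))
    (solve 2 (λ R x → R :* x :+ # 1 :- x := (R :- # 1) :* x :+ # 1) refl (κ ρ) x)

α : ℚ → ℚ → ℚ
α R x = κ 12 * x + κ 7 * σ R x

-- With m = n+1, `Q a ρ n` is 12 m Θ_m and `Q b ρ n` is 12 m P_m; the shift avoids a predecessor.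
Q : (ℕ → ℚ) → ℕ → ℕ → ℚ
Q f ρ n = α (κ ρ) (κ (suc n)) * f (suc n) + σ (κ ρ) (κ (suc n)) * f n

12xΘ≡Q : ∀ ρ n → κ 12 * κ (suc n) * Θ ρ (suc n) ≡ Q a ρ n
12xΘ≡Q ρ n = begin
  κ 12 * x * Θ ρ (suc n)                       ≡⟨ cong (κ 12 * x *_) (Θ-formula ρ n) ⟩
  κ 12 * x * (a (suc n) + s * T (suc n))
    ≡⟨ solve 4 (λ x a s t → # 12 :* x :* (a :+ s :* t) := # 12 :* x :* a :+ s :* (# 12 :* x :* t)) refl x (a (suc n)) s (T (suc n)) ⟩
  κ 12 * x * a (suc n) + s * (κ 12 * x * T (suc n))
    ≡⟨ cong (λ z → κ 12 * x * a (suc n) + s * z) (T-formula n) ⟩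
  κ 12 * x * a (suc n) + s * (κ 7 * a (suc n) + a n)
    ≡⟨ solve 4 (λ x a s a′ → # 12 :* x :* a :+ s :* (# 7 :* a :+ a′) := (# 12 :* x :+ # 7 :* s) :* a :+ s :* a′)
         refl x (a (suc n)) s (a n) ⟩
  Q a ρ n ∎
  where
  open ≡-Reasoning
  x s : ℚ
  x = κ (suc n)
  s = σ (κ ρ) x

-- Partial sums of the series

infix 4 _↦_
infixl 6 _⊞_ _⊟_
infixl 7 _⊠_

-- A record, so that the integer is recovered by unification from the type of a proof.
record _↦_ (i : ℤ) (p : ℚ) : Set where
  constructor cast
  field cast≡ : ℤ→ℚ i ≡ p
open _↦_

_⊞_ : ∀ {i j p q} → i ↦ p → j ↦ q → i ℤ.+ j ↦ p + q
_⊞_ {i} {j} (cast eq) (cast eq′) = cast (trans (ℤ→ℚ-homo-+ i j) (cong₂ _+_ eq eq′))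

_⊟_ : ∀ {i j p q} → i ↦ p → j ↦ q → i ℤ.- j ↦ p - q
_⊟_ {j = j} i↦p (cast eq) = i↦p ⊞ cast (trans (ℤ→ℚ-homo-neg j) (cong -_ eq))

_⊠_ : ∀ {i j p q} → i ↦ p → j ↦ q → i ℤ.* j ↦ p * q
_⊠_ {i} {j} (cast eq) (cast eq′) = cast (trans (ℤ→ℚ-homo-* i j) (cong₂ _*_ eq eq′))

-- The proof term mirrors the bracketing of `Φ`, so its integer side is the polynomial in `Φ` itself
-- and its rational side is open to the solver.
Φ-cast : ∀ ρ n → let R = κ ρ; x = κ n; x² = x * x; x³ = x² * x; x⁴ = x³ * x; x⁵ = x⁴ * x; R² = R * R in
  Φ ρ n ≡ κ 24 * x⁵ * R² - κ 12 * x⁵ + κ 54 * x⁴ * R² + κ 39 * x⁴ * R - κ 33 * x⁴ + κ 46 * x³ * R²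
    + κ 70 * x³ * R + κ 19 * x² * R² + κ 56 * x² * R + κ 33 * x² + κ 3 * x * R² + κ 21 * x * R
    + κ 24 * x + κ 3 * R + κ 5
Φ-cast ρ n = cast≡ (nat 24 ⊠ x⁵ ⊠ R² ⊟ nat 12 ⊠ x⁵ ⊞ nat 54 ⊠ x⁴ ⊠ R² ⊞ nat 39 ⊠ x⁴ ⊠ R ⊟ nat 33 ⊠ x⁴ ⊞ nat 46 ⊠ x³ ⊠ R²
    ⊞ nat 70 ⊠ x³ ⊠ R ⊞ nat 19 ⊠ x² ⊠ R² ⊞ nat 56 ⊠ x² ⊠ R ⊞ nat 33 ⊠ x² ⊞ nat 3 ⊠ x ⊠ R² ⊞ nat 21 ⊠ x ⊠ R
    ⊞ nat 24 ⊠ x ⊞ nat 3 ⊠ R ⊞ nat 5)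
  where
  nat : ∀ m → + m ↦ κ m
  nat m = cast refl
  x = nat n
  x² = x ⊠ x
  x³ = x² ⊠ x
  x⁴ = x³ ⊠ x
  x⁵ = x⁴ ⊠ x
  R = nat ρ
  R² = R ⊠ R

-- The origin of Φ: the left side is the coefficient that `mixed-casoratian` leaves over.
Φ-identity : ∀ ρ n → let R = κ ρ; x = κ n in
  α R (x + 1ℚ) * α R x * cube x + α R (x + 1ℚ) * σ R x * aperyP x + σ R (x + 1ℚ) * σ R x * cube (x + 1ℚ)
    ≡ κ 12 * Φ ρ n
Φ-identity ρ n = trans (solve 2 (λ R x → let
    x² = x :* x; x³ = x² :* x; x⁴ = x³ :* x; x⁵ = x⁴ :* x; R² = R :* R
    :σ = λ z → (R :- # 1) :* z :+ # 1; :α = λ z → # 12 :* z :+ # 7 :* :σ z in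
  :α (x :+ # 1) :* :α x :* :cube x :+ :α (x :+ # 1) :* :σ x :* :aperyP x :+ :σ (x :+ # 1) :* :σ x :* :cube (x :+ # 1)
    := # 12 :* (# 24 :* x⁵ :* R² :- # 12 :* x⁵ :+ # 54 :* x⁴ :* R² :+ # 39 :* x⁴ :* R :- # 33 :* x⁴ :+ # 46 :* x³ :* R²
    :+ # 70 :* x³ :* R :+ # 19 :* x² :* R² :+ # 56 :* x² :* R :+ # 33 :* x² :+ # 3 :* x :* R² :+ # 21 :* x :* R
    :+ # 24 :* x :+ # 3 :* R :+ # 5)) refl (κ ρ) (κ n)) (cong (κ 12 *_) (sym (Φ-cast ρ n)))

-- The α σ′ terms cancel. The α′ α and σ′ σ terms carry Casoratians of adjacent rows, and in the α′
-- σ term the recurrences reduce b₂ a₀ - a₂ b₀ to P times such a Casoratian.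
mixed-casoratian : ∀ x P α′ α σ′ σ a₀ a₁ a₂ b₀ b₁ b₂ →
  cube (x + 1ℚ) * a₂ - P * a₁ + cube x * a₀ ≡ 0ℚ → cube (x + 1ℚ) * b₂ - P * b₁ + cube x * b₀ ≡ 0ℚ →
  cube x * (b₁ * a₀ - a₁ * b₀) ≡ κ 6 → cube (x + 1ℚ) * (b₂ * a₁ - a₂ * b₁) ≡ κ 6 →
  cube x * cube (x + 1ℚ) * ((α′ * b₂ + σ′ * b₁) * (α * a₁ + σ * a₀) - (α * b₁ + σ * b₀) * (α′ * a₂ + σ′ * a₁))
    ≡ κ 6 * (α′ * α * cube x + α′ * σ * P + σ′ * σ * cube (x + 1ℚ))
mixed-casoratian x P α′ α σ′ σ a₀ a₁ a₂ b₀ b₁ b₂ a-rec b-rec W₀ W₁ = begin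
  _ ≡⟨ solve 13 (λ X Y P α′ α σ′ σ a₀ a₁ a₂ b₀ b₁ b₂ →
      X :* Y :* ((α′ :* b₂ :+ σ′ :* b₁) :* (α :* a₁ :+ σ :* a₀) :- (α :* b₁ :+ σ :* b₀) :* (α′ :* a₂ :+ σ′ :* a₁))
      := α′ :* α :* X :* (Y :* (b₂ :* a₁ :- a₂ :* b₁)) :+ σ′ :* σ :* Y :* (X :* (b₁ :* a₀ :- a₁ :* b₀))
        :+ α′ :* σ :* P :* (X :* (b₁ :* a₀ :- a₁ :* b₀))
        :+ α′ :* σ :* X :* ((Y :* b₂ :- P :* b₁ :+ X :* b₀) :* a₀ :- (Y :* a₂ :- P :* a₁ :+ X :* a₀) :* b₀))
      refl (cube x) (cube (x + 1ℚ)) P α′ α σ′ σ a₀ a₁ a₂ b₀ b₁ b₂ ⟩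
  _ ≡⟨ cong₂ _+_ (cong₂ (λ w₀ w₁ → α′ * α * cube x * w₁ + σ′ * σ * cube (x + 1ℚ) * w₀ + α′ * σ * P * w₀) W₀ W₁)
         (cong₂ (λ p q → α′ * σ * cube x * (p * a₀ - q * b₀)) b-rec a-rec) ⟩
  _ ≡⟨ solve 9 (λ X Y P α′ α σ′ σ a₀ b₀ →
      α′ :* α :* X :* # 6 :+ σ′ :* σ :* Y :* # 6 :+ α′ :* σ :* P :* # 6 :+ α′ :* σ :* X :* (# 0 :* a₀ :- # 0 :* b₀)
      := # 6 :* (α′ :* α :* X :+ α′ :* σ :* P :+ σ′ :* σ :* Y)) refl (cube x) (cube (x + 1ℚ)) P α′ α σ′ σ a₀ b₀ ⟩
  _ ∎
  where open ≡-Reasoning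

Q-casoratian : ∀ ρ n → let x = κ (suc n) in
  cube x * cube (x + 1ℚ) * (Q b ρ (suc n) * Q a ρ n - Q b ρ n * Q a ρ (suc n)) ≡ κ 72 * Φ ρ (suc n)
Q-casoratian ρ n = core (κ-suc (suc n)) (casoratian (suc n))
  where
  R x : ℚ
  R = κ ρ
  x = κ (suc n)
  core : ∀ {x′} → x′ ≡ x + 1ℚ → cube x′ * (b (suc (suc n)) * a (suc n) - a (suc (suc n)) * b (suc n)) ≡ κ 6 →
    cube x * cube (x + 1ℚ) * ((α R x′ * b (suc (suc n)) + σ R x′ * b (suc n)) * Q a ρ n
      - Q b ρ n * (α R x′ * a (suc (suc n)) + σ R x′ * a (suc n))) ≡ κ 72 * Φ ρ (suc n)
  core refl W₁ = trans
    (mixed-casoratian x (aperyP x) (α R (x + 1ℚ)) (α R x) (σ R (x + 1ℚ)) (σ R x) (a n) (a (suc n)) (a (suc (suc n)))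
      (b n) (b (suc n)) (b (suc (suc n))) (a-recurrence n) (b-recurrence n) (casoratian n) W₁)
    (trans (cong (κ 6 *_) (Φ-identity ρ (suc n)))
      (solve 1 (λ z → # 6 :* (# 12 :* z) := # 72 :* z) refl (Φ ρ (suc n))))

-- Lower bounds and positivity

u≥1 : ∀ {n k} → k ℕ.≤ n → 1ℚ ≤ u (κ n) k
u≥1 ℕ.z≤n = ≤-refl
u≥1 {suc n} {suc k} (ℕ.s≤s k≤n) = begin
  1ℚ                                                    ≤⟨ u≥1 k≤n ⟩
  u x k                                                 ≡⟨ u≡g x k ⟩
  -- The induction moves along the diagonal from (n,k) to (n+1,k+1), where the quotient
  -- (n+k+1)(n+k+2)/(k+1)² is visibly at least 1 and no factor n - k occurs.
  g x k * (K k * K k)                                   ≤⟨ *-monoˡ-≤₀ 0≤g (*-mono-≤₀ 0≤K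
    (K≤ 1ℚ ≤-refl) 0≤K (K≤ (κ 2) (κ-mono {1} {2} (ℕ.s≤s ℕ.z≤n)))) ⟩
  g x k * ((x + κ k + 1ℚ) * (x + κ k + κ 2))            ≡⟨ u-up x k ⟨
  u (x + 1ℚ) (suc k)                                    ≡⟨ cong (λ z → u z (suc k)) (κ-suc n) ⟨
  u (κ (suc n)) (suc k) ∎
  where
  open ≤-Reasoning
  x : ℚ
  x = κ n
  0≤K : 0ℚ ≤ K k
  0≤K = +-nonNeg (0≤κ k) (<⇒≤ 0<1)
  K≤ : ∀ q → 1ℚ ≤ q → K k ≤ x + κ k + q
  K≤ q 1≤q = +-mono-≤ (subst (_≤ x + κ k) (+-identityˡ (κ k)) (+-monoˡ-≤ (κ k) (0≤κ n))) 1≤q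
  0≤g : 0ℚ ≤ g x k
  0≤g = *-nonNeg (≤-trans (<⇒≤ 0<1) (u≥1 k≤n)) (inv-nonNeg (*-pos (+-pos (0≤κ k) 0<1) (+-pos (0≤κ k) 0<1)))

Λ-pos : ∀ {n k} → k ℕ.≤ n → 0ℚ < Λ (κ n) k
Λ-pos k≤n = *-pos (<-≤-trans 0<1 (u≥1 k≤n)) (<-≤-trans 0<1 (u≥1 k≤n))

Σ-nonNeg : ∀ {f : ℕ → ℚ} N → (∀ {k} → k ℕ.< N → 0ℚ ≤ f k) → 0ℚ ≤ Σ< N f
Σ-nonNeg zero 0≤f = ≤-refl
Σ-nonNeg (suc N) 0≤f = +-nonNeg (Σ-nonNeg N (λ k<N → 0≤f (ℕ.m<n⇒m<1+n k<N))) (0≤f ℕ.≤-refl)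

a-pos : ∀ n → 0ℚ < a n
a-pos n = +-pos (Σ-nonNeg n (λ k<n → <⇒≤ (Λ-pos (ℕ.<⇒≤ k<n)))) (Λ-pos (ℕ.≤-refl {n}))

p≤q⇒0≤q-p : ∀ {p q} → p ≤ q → 0ℚ ≤ q - p
p≤q⇒0≤q-p {p} {q} p≤q = subst (_≤ q - p) (+-inverseʳ p) (+-monoˡ-≤ (- p) p≤q)

module _ {ρ : ℕ} (1≤ρ : 1 ℕ.≤ ρ) where
  -- Here 1 ≤ ρ enters; for ρ = 0 the value would be 1 - n.
  σ-pos : ∀ n → 0ℚ < σ (κ ρ) (κ n)
  σ-pos n = +-pos (*-nonNeg (p≤q⇒0≤q-p (κ-mono 1≤ρ)) (0≤κ n)) 0<1

  α-pos : ∀ n → 0ℚ < α (κ ρ) (κ n)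
  α-pos n = +-pos (*-nonNeg (0≤κ 12) (0≤κ n)) (*-pos (0<κ 6) (σ-pos n))

  Q-pos : ∀ n → 0ℚ < Q a ρ n
  Q-pos n = +-pos (<⇒≤ (*-pos (α-pos (suc n)) (a-pos (suc n)))) (*-pos (σ-pos (suc n)) (a-pos n))

  Θ≢0 : ∀ n → Θ ρ (suc n) ≢ 0ℚ
  Θ≢0 n = ≢0-factorʳ {κ 12 * κ (suc n)} (subst (_≢ 0ℚ) (sym (12xΘ≡Q ρ n)) (pos⇒≢0 (Q-pos n)))

fourth : ℚ → ℚ
fourth x = x * (x * (x * x))

κ-^4 : ∀ m → κ (m ℕ.^ 4) ≡ fourth (κ m)
κ-^4 m = begin
  κ (m ℕ.* (m ℕ.* (m ℕ.* (m ℕ.* 1))))  ≡⟨ cong (λ z → κ (m ℕ.* (m ℕ.* (m ℕ.* z)))) (ℕ.*-identityʳ m) ⟩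
  κ (m ℕ.* (m ℕ.* (m ℕ.* m)))          ≡⟨ κ-* m (m ℕ.* (m ℕ.* m)) ⟩
  κ m * κ (m ℕ.* (m ℕ.* m))            ≡⟨ cong (κ m *_) (κ-* m (m ℕ.* m)) ⟩
  κ m * (κ m * κ (m ℕ.* m))            ≡⟨ cong (λ z → κ m * (κ m * z)) (κ-* m m) ⟩
  fourth (κ m) ∎
  where open ≡-Reasoning

convergent : ℕ → ℕ → ℚ
convergent ρ n = Q b ρ n ÷' Q a ρ n

summand≡difference : ∀ {ρ} → 1 ℕ.≤ ρ → ∀ n → summand ρ (suc n) ≡ convergent ρ (suc n) - convergent ρ n
summand≡difference {ρ} 1≤ρ n = trans
  (cong (λ m → Φ ρ (suc n) ÷' (κ (2 ℕ.* suc n ℕ.^ 4 ℕ.* m ℕ.^ 4) * Θ ρ (suc n) * Θ ρ m)) (ℕ.+-comm (suc n) 1))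
  (÷-unique {Φ ρ (suc n)} {D} {p′ * inv q′ - p * inv q} D≢0
    (*-cancelˡ {κ 72} {D * (p′ * inv q′ - p * inv q)} {Φ ρ (suc n)} (pos⇒≢0 (0<κ 71)) (begin
    κ 72 * (D * (p′ * inv q′ - p * inv q))
      ≡⟨ cong (λ z → κ 72 * (z * Θ₁ * Θ₂ * (p′ * inv q′ - p * inv q))) D-cast ⟩
    κ 72 * (κ 2 * fourth x * fourth (x + 1ℚ) * Θ₁ * Θ₂ * (p′ * inv q′ - p * inv q))
      -- Since 72 · 2 = 12 · 12, each Θ receives its own factor 12 x or 12 (x + 1), and the cubes
      -- demanded by `Q-casoratian` are left over.
      ≡⟨ solve 4 (λ x t t′ z → let y = x :+ # 1 in
           # 72 :* (# 2 :* (x :* (x :* (x :* x))) :* (y :* (y :* (y :* y))) :* t :* t′ :* z)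
           := :cube x :* :cube y :* ((# 12 :* x :* t) :* (# 12 :* y :* t′) :* z)) refl x Θ₁ Θ₂ (p′ * inv q′ - p * inv q) ⟩
    cube x * cube (x + 1ℚ) * ((κ 12 * x * Θ₁) * (κ 12 * (x + 1ℚ) * Θ₂) * (p′ * inv q′ - p * inv q))
      ≡⟨ cong₂ (λ y z → cube x * cube (x + 1ℚ) * (y * z * (p′ * inv q′ - p * inv q))) (12xΘ≡Q ρ n)
           (trans (cong (λ z → κ 12 * z * Θ₂) (sym (κ-suc (suc n)))) (12xΘ≡Q ρ (suc n))) ⟩
    cube x * cube (x + 1ℚ) * (q * q′ * (p′ * inv q′ - p * inv q))
      ≡⟨ solve 7 (λ c p p′ q q′ i i′ → c :* (q :* q′ :* (p′ :* i′ :- p :* i))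
           := c :* (p′ :* q :* (q′ :* i′) :- p :* q′ :* (q :* i))) refl (cube x * cube (x + 1ℚ)) p p′ q q′ (inv q) (inv q′) ⟩
    cube x * cube (x + 1ℚ) * (p′ * q * (q′ * inv q′) - p * q′ * (q * inv q))
      ≡⟨ cong₂ (λ y z → cube x * cube (x + 1ℚ) * (p′ * q * y - p * q′ * z)) (inv-right q′≢0) (inv-right q≢0) ⟩
    cube x * cube (x + 1ℚ) * (p′ * q * 1ℚ - p * q′ * 1ℚ)
      ≡⟨ cong₂ (λ y z → cube x * cube (x + 1ℚ) * (y - z)) (*-identityʳ (p′ * q)) (*-identityʳ (p * q′)) ⟩
    cube x * cube (x + 1ℚ) * (p′ * q - p * q′)
      ≡⟨ Q-casoratian ρ n ⟩
    κ 72 * Φ ρ (suc n) ∎)))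
  where
  open ≡-Reasoning
  x p p′ q q′ Θ₁ Θ₂ D : ℚ
  x = κ (suc n)
  p = Q b ρ n
  p′ = Q b ρ (suc n)
  q = Q a ρ n
  q′ = Q a ρ (suc n)
  Θ₁ = Θ ρ (suc n)
  Θ₂ = Θ ρ (suc (suc n))
  D = κ (2 ℕ.* suc n ℕ.^ 4 ℕ.* suc (suc n) ℕ.^ 4) * Θ₁ * Θ₂
  q≢0 : q ≢ 0ℚ
  q≢0 = pos⇒≢0 (Q-pos 1≤ρ n)
  q′≢0 : q′ ≢ 0ℚ
  q′≢0 = pos⇒≢0 (Q-pos 1≤ρ (suc n))
  0<x : 0ℚ < x
  0<x = 0<κ n
  0<x+1 : 0ℚ < x + 1ℚ
  0<x+1 = +-pos (<⇒≤ 0<x) 0<1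
  fourth-pos : ∀ {z} → 0ℚ < z → 0ℚ < fourth z
  fourth-pos 0<z = *-pos 0<z (*-pos 0<z (*-pos 0<z 0<z))
  D-cast : κ (2 ℕ.* suc n ℕ.^ 4 ℕ.* suc (suc n) ℕ.^ 4) ≡ κ 2 * fourth x * fourth (x + 1ℚ)
  D-cast = trans (κ-* (2 ℕ.* suc n ℕ.^ 4) (suc (suc n) ℕ.^ 4)) (cong₂ _*_
    (trans (κ-* 2 (suc n ℕ.^ 4)) (cong (κ 2 *_) (κ-^4 (suc n))))
    (trans (κ-^4 (suc (suc n))) (cong fourth (κ-suc (suc n)))))
  D≢0 : D ≢ 0ℚ
  D≢0 = *-≢0 (*-≢0 (subst (_≢ 0ℚ) (sym D-cast)
    (pos⇒≢0 (*-pos (*-pos (0<κ 1) (fourth-pos 0<x)) (fourth-pos 0<x+1)))) (Θ≢0 1≤ρ n)) (Θ≢0 1≤ρ (suc n))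

-- At index 1, σ equals ρ, and the rows 1, 5 and 0, 6 give 6(7ρ+12) / (5(7ρ+12) + ρ).
convergent₀ : ∀ {ρ} → 1 ℕ.≤ ρ → convergent ρ 0 ≡ const ρ
convergent₀ {ρ} 1≤ρ = ÷-unique (pos⇒≢0 (Q-pos 1≤ρ 0)) (begin
  Q a ρ 0 * (κ (7 ℕ.* ρ ℕ.+ 12) * inv D)
    ≡⟨ cong (λ z → Q a ρ 0 * (z * inv D)) (κ-affine 7 12) ⟩
  Q a ρ 0 * ((κ 7 * R + κ 12) * inv D)
    ≡⟨ solve 2 (λ R i → let s = (R :- # 1) :* # 1 :+ # 1 in
         ((# 12 :* # 1 :+ # 7 :* s) :* # 5 :+ s :* # 1) :* ((# 7 :* R :+ # 12) :* i)
         := (# 6 :* R :+ # 10) :* i :* ((# 12 :* # 1 :+ # 7 :* s) :* # 6 :+ s :* # 0)) refl R (inv D) ⟩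
  (κ 6 * R + κ 10) * inv D * Q b ρ 0   ≡⟨ cong (λ z → z * inv D * Q b ρ 0) (κ-affine 6 10) ⟨
  D * inv D * Q b ρ 0                  ≡⟨ cong (_* Q b ρ 0) (inv-right (pos⇒≢0 0<D)) ⟩
  1ℚ * Q b ρ 0                         ≡⟨ *-identityˡ (Q b ρ 0) ⟩
  Q b ρ 0 ∎)
  where
  open ≡-Reasoning
  R D : ℚ
  R = κ ρ
  D = κ (6 ℕ.* ρ ℕ.+ 10)
  κ-affine : ∀ m n → κ (m ℕ.* ρ ℕ.+ n) ≡ κ m * R + κ n
  κ-affine m n = trans (κ-+ (m ℕ.* ρ) n) (cong (_+ κ n) (κ-* m ρ))
  0<D : 0ℚ < D
  0<D = subst (0ℚ <_) (sym (κ-+ (6 ℕ.* ρ) 10)) (+-pos (0≤κ (6 ℕ.* ρ)) (0<κ 9))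

partial-sum : ∀ {ρ} → 1 ℕ.≤ ρ → ∀ M → const ρ + seriesPartial ρ M ≡ convergent ρ M
partial-sum {ρ} 1≤ρ zero = trans (+-identityʳ (const ρ)) (sym (convergent₀ 1≤ρ))
partial-sum {ρ} 1≤ρ (suc M) = begin
  const ρ + (seriesPartial ρ M + summand ρ (suc M))  ≡⟨ +-assoc (const ρ) (seriesPartial ρ M) (summand ρ (suc M)) ⟨
  const ρ + seriesPartial ρ M + summand ρ (suc M)    ≡⟨ cong₂ _+_ (partial-sum 1≤ρ M) (summand≡difference 1≤ρ M) ⟩
  convergent ρ M + (convergent ρ (suc M) - convergent ρ M)
    ≡⟨ solve 2 (λ p q → p :+ (q :- p) := q) refl (convergent ρ M) (convergent ρ (suc M)) ⟩
  convergent ρ (suc M) ∎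
  where open ≡-Reasoning

-- Convergence

∣sgn∣ : ∀ k → ∣ sgn k ∣ ≡ 1ℚ
∣sgn∣ zero = refl
∣sgn∣ (suc k) = trans (∣p*q∣≡∣p∣*∣q∣ (sgn k) (- 1ℚ)) (cong (_* 1ℚ) (∣sgn∣ k))

∣p*q∣≤ : ∀ {p q e} → 0ℚ ≤ p → ∣ q ∣ ≤ e → ∣ p * q ∣ ≤ p * e
∣p*q∣≤ {p} {q} {e} 0≤p ∣q∣≤e = subst (_≤ p * e)
  (sym (trans (∣p*q∣≡∣p∣*∣q∣ p q) (cong (_* ∣ q ∣) (0≤p⇒∣p∣≡p 0≤p)))) (*-monoˡ-≤₀ 0≤p ∣q∣≤e)

∣p+q∣≤ : ∀ {p q e f} → ∣ p ∣ ≤ e → ∣ q ∣ ≤ f → ∣ p + q ∣ ≤ e + f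
∣p+q∣≤ {p} {q} ∣p∣≤e ∣q∣≤f = ≤-trans (∣p+q∣≤∣p∣+∣q∣ p q) (+-mono-≤ ∣p∣≤e ∣q∣≤f)

-- K (x - k) ≥ x because (K - 1) (x - K) ≥ 0.
d-denominator : ∀ k j → let x = κ (suc k ℕ.+ j) in x * x ≤ κ 2 * cube (K k) * u x (suc k)
d-denominator k j = begin
  x * x                                              ≤⟨ *-mono-≤₀ 0≤x x≤K[x-k] 0≤x x≤x+K ⟩
  K k * (x - κ k) * (x + κ k + 1ℚ)                   ≡⟨ *-identityˡ (K k * (x - κ k) * (x + κ k + 1ℚ)) ⟨
  1ℚ * (K k * (x - κ k) * (x + κ k + 1ℚ))
    ≤⟨ *-mono-≤₀ (<⇒≤ 0<1) (≤-trans (u≥1 k≤n) (p≤p+q (u x k) 0≤u)) (≤-trans (*-nonNeg 0≤x 0≤x)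
         (*-mono-≤₀ 0≤x x≤K[x-k] 0≤x x≤x+K)) ≤-refl ⟩
  (u x k + u x k) * (K k * (x - κ k) * (x + κ k + 1ℚ))
    ≡⟨ cong (λ z → (z + z) * (K k * (x - κ k) * (x + κ k + 1ℚ))) (u≡g x k) ⟩
  (g x k * (K k * K k) + g x k * (K k * K k)) * (K k * (x - κ k) * (x + κ k + 1ℚ))
    ≡⟨ solve 4 (λ g K p q → (g :* (K :* K) :+ g :* (K :* K)) :* (K :* p :* q) := # 2 :* :cube K :* (g :* (p :* q)))
         refl (g x k) (K k) (x - κ k) (x + κ k + 1ℚ) ⟩
  κ 2 * cube (K k) * u x (suc k) ∎
  where
  open ≤-Reasoning
  x : ℚ
  x = κ (suc k ℕ.+ j)
  x≡ : x ≡ K k + κ j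
  x≡ = trans (κ-+ (suc k) j) (cong (_+ κ j) (κ-suc k))
  0≤x : 0ℚ ≤ x
  0≤x = 0≤κ (suc k ℕ.+ j)
  k≤n : k ℕ.≤ suc k ℕ.+ j
  k≤n = ℕ.m≤n⇒m≤1+n (ℕ.m≤m+n k j)
  0≤u : 0ℚ ≤ u x k
  0≤u = ≤-trans (<⇒≤ 0<1) (u≥1 k≤n)
  x≤x+K : x ≤ x + κ k + 1ℚ
  x≤x+K = ≤-trans (p≤p+q x (0≤κ k)) (p≤p+q (x + κ k) (<⇒≤ 0<1))
  x≤K[x-k] : x ≤ K k * (x - κ k)
  x≤K[x-k] = subst (λ z → z ≤ K k * (z - κ k)) (sym x≡) (subst (K k + κ j ≤_)
    (solve 2 (λ k j → let K = k :+ # 1 in K :+ j :+ k :* j := K :* (K :+ j :- k)) refl (κ k) (κ j))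
    (p≤p+q (K k + κ j) (*-nonNeg (0≤κ k) (0≤κ j))))

∣d∣≤ : ∀ {n k} → k ℕ.< n → ∣ d (κ n) k ∣ ≤ inv (κ n * κ n)
∣d∣≤ {suc n} {k} k<n = begin
  ∣ sgn k * inv D ∣      ≡⟨ ∣p*q∣≡∣p∣*∣q∣ (sgn k) (inv D) ⟩
  ∣ sgn k ∣ * ∣ inv D ∣  ≡⟨ cong₂ _*_ (∣sgn∣ k) (0≤p⇒∣p∣≡p (inv-nonNeg (<-≤-trans 0<x² x²≤D))) ⟩
  1ℚ * inv D             ≡⟨ *-identityˡ (inv D) ⟩
  inv D                  ≤⟨ inv-antitone 0<x² x²≤D ⟩
  inv (x * x) ∎
  where
  open ≤-Reasoning
  x D : ℚ
  x = κ (suc n)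
  D = κ 2 * cube (K k) * u x (suc k)
  0<x² : 0ℚ < x * x
  0<x² = *-pos (0<κ n) (0<κ n)
  x²≤D : x * x ≤ D
  x²≤D = subst (λ m → κ m * κ m ≤ κ 2 * cube (K k) * u (κ m) (suc k)) (ℕ.m+[n∸m]≡n k<n)
    (d-denominator k (suc n ℕ.∸ suc k))

∣Σd∣≤ : ∀ n k → k ℕ.≤ n → ∣ Σ< k (d (κ n)) ∣ ≤ κ k * inv (κ n * κ n)
∣Σd∣≤ n zero _ = subst (0ℚ ≤_) (sym (*-zeroˡ (inv (κ n * κ n)))) ≤-refl
∣Σd∣≤ n (suc k) k<n = subst (∣ Σ< (suc k) (d (κ n)) ∣ ≤_)
  (trans (solve 2 (λ k i → k :* i :+ i := (k :+ # 1) :* i) refl (κ k) (inv (κ n * κ n)))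
    (cong (_* inv (κ n * κ n)) (sym (κ-suc k))))
  (∣p+q∣≤ {Σ< k (d (κ n))} {d (κ n) k} (∣Σd∣≤ n k (ℕ.<⇒≤ k<n)) (∣d∣≤ k<n))

-- At most n+1 correction terms, each at most 1/(n+1)².
∣c-h∣≤ : ∀ h n {k} → k ℕ.≤ suc n → ∣ c h (κ (suc n)) k - h ∣ ≤ inv (κ (suc n))
∣c-h∣≤ h n {k} k≤n = begin
  ∣ h + S - h ∣        ≡⟨ cong ∣_∣ (solve 2 (λ h s → h :+ s :- h := s) refl h S) ⟩
  ∣ S ∣                ≤⟨ ∣Σd∣≤ (suc n) k k≤n ⟩
  κ k * inv (x * x)    ≤⟨ *-mono-≤₀ (0≤κ k) (κ-mono k≤n) (inv-nonNeg (*-pos (0<κ n) (0<κ n))) ≤-refl ⟩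
  x * inv (x * x)      ≡⟨ ÷-unique (*-≢0 x≢0 x≢0) (trans (*-assoc x x (inv x))
                            (trans (cong (x *_) (inv-right x≢0)) (*-identityʳ x))) ⟩
  inv x ∎
  where
  open ≤-Reasoning
  x S : ℚ
  x = κ (suc n)
  S = Σ< k (d x)
  x≢0 : x ≢ 0ℚ
  x≢0 = pos⇒≢0 (0<κ n)

weighted-average : ∀ {w v : ℕ → ℚ} {h e} N → (∀ {k} → k ℕ.< N → 0ℚ ≤ w k) → (∀ {k} → k ℕ.< N → ∣ v k - h ∣ ≤ e) →
  ∣ Σ< N (λ k → w k * v k) - h * Σ< N w ∣ ≤ Σ< N w * e
weighted-average {h = h} {e} zero _ _ = subst₂ (λ p q → ∣ p ∣ ≤ q)
  (solve 1 (λ h → # 0 := # 0 :- h :* # 0) refl h) (sym (*-zeroˡ e)) ≤-refl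
weighted-average {w} {v} {h} {e} (suc N) 0≤w v≈h = subst₂ (λ p q → ∣ p ∣ ≤ q)
  (solve 5 (λ S W w v h → S :- h :* W :+ w :* (v :- h) := S :+ w :* v :- h :* (W :+ w)) refl S W (w N) (v N) h)
  (sym (*-distribʳ-+ e W (w N)))
  (∣p+q∣≤ {S - h * W} {w N * (v N - h)}
    (weighted-average N (λ k<N → 0≤w (ℕ.m<n⇒m<1+n k<N)) (λ k<N → v≈h (ℕ.m<n⇒m<1+n k<N)))
    (∣p*q∣≤ (0≤w ℕ.≤-refl) (v≈h ℕ.≤-refl)))
  where
  S W : ℚ
  S = Σ< N (λ k → w k * v k)
  W = Σ< N w

b≈ζa : ∀ n → ∣ b (suc n) - zeta3Partial (suc n) * a (suc n) ∣ ≤ a (suc n) * inv (κ (suc n))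
b≈ζa n = weighted-average (suc (suc n)) (λ k<N → <⇒≤ (Λ-pos (ℕ.s≤s⁻¹ k<N)))
  (λ k<N → ∣c-h∣≤ (zeta3Partial (suc n)) n (ℕ.s≤s⁻¹ k<N))

-- The convergent at n+1 mixes rows n+1 and n+2, but both must be compared with the same partial sum
-- of ζ(3). Dropping its last term costs 1/(n+2)³, which is at most 1/(n+1).
b≈ζa′ : ∀ n → ∣ b (suc (suc n)) - zeta3Partial (suc n) * a (suc (suc n)) ∣
  ≤ a (suc (suc n)) * (inv (κ (suc n)) + inv (κ (suc n)))
b≈ζa′ n = subst₂ (λ p q → ∣ p ∣ ≤ q)
  (trans (cong (λ z → b₂ - z * a₂ + a₂ * i) (zeta3-suc (suc n) refl))
    (solve 4 (λ b h i a → b :- (h :+ i) :* a :+ a :* i := b :- h :* a) refl b₂ h i a₂))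
  (sym (*-distribˡ-+ a₂ (inv x) (inv x)))
  (∣p+q∣≤ {b₂ - zeta3Partial (suc (suc n)) * a₂} {a₂ * i}
    (≤-trans (b≈ζa (suc n)) (*-monoˡ-≤₀ 0≤a (inv-antitone 0<x x≤y)))
    (∣p*q∣≤ 0≤a (≤-trans (≤-reflexive (0≤p⇒∣p∣≡p (inv-nonNeg (<-≤-trans 0<x x≤y³)))) (inv-antitone 0<x x≤y³))))
  where
  x y h i a₂ b₂ : ℚ
  x = κ (suc n)
  y = κ (suc (suc n))
  h = zeta3Partial (suc n)
  i = inv (cube y)
  a₂ = a (suc (suc n))
  b₂ = b (suc (suc n))
  0<x : 0ℚ < x
  0<x = 0<κ n
  0≤a : 0ℚ ≤ a₂
  0≤a = <⇒≤ (a-pos (suc (suc n)))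
  x≤y : x ≤ y
  x≤y = κ-mono (ℕ.n≤1+n (suc n))
  1≤y : 1ℚ ≤ y
  1≤y = κ-mono {1} {suc (suc n)} (ℕ.s≤s ℕ.z≤n)
  0≤1 : 0ℚ ≤ 1ℚ
  0≤1 = <⇒≤ 0<1
  x≤y³ : x ≤ cube y
  x≤y³ = subst (_≤ cube y) (*-identityˡ x) (*-mono-≤₀ 0≤1 (*-mono-≤₀ 0≤1 1≤y 0≤1 1≤y) (<⇒≤ 0<x) x≤y)

convergent-error : ∀ {ρ} → 1 ℕ.≤ ρ → ∀ n →
  ∣ zeta3Partial (suc n) - convergent ρ (suc n) ∣ ≤ inv (κ (suc n)) + inv (κ (suc n))
convergent-error {ρ} 1≤ρ n = *-cancelˡ-≤₀ 0<q (begin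
  q * ∣ h - p * inv q ∣          ≡⟨ cong (_* ∣ h - p * inv q ∣) (0≤p⇒∣p∣≡p (<⇒≤ 0<q)) ⟨
  ∣ q ∣ * ∣ h - p * inv q ∣      ≡⟨ ∣p*q∣≡∣p∣*∣q∣ q (h - p * inv q) ⟨
  ∣ q * (h - p * inv q) ∣        ≡⟨ cong ∣_∣ (trans
    (solve 4 (λ q h p i → q :* (h :- p :* i) := q :* h :- p :* (q :* i)) refl q h p (inv q))
    (trans (cong (λ z → q * h - p * z) (inv-right (pos⇒≢0 0<q)))
      (solve 3 (λ q h p → q :* h :- p :* # 1 := :- (p :- h :* q)) refl q h p))) ⟩
  ∣ - (p - h * q) ∣              ≡⟨ ∣-p∣≡∣p∣ (p - h * q) ⟩
  ∣ p - h * q ∣                  ≡⟨ cong ∣_∣ (solve 7 (λ α σ b₂ b₁ a₂ a₁ h → α :* b₂ :+ σ :* b₁ :- h :* (α :* a₂ :+ σ :* a₁)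
                                      := α :* (b₂ :- h :* a₂) :+ σ :* (b₁ :- h :* a₁)) refl A s b₂ b₁ a₂ a₁ h) ⟩
  ∣ A * (b₂ - h * a₂) + s * (b₁ - h * a₁) ∣
    ≤⟨ ∣p+q∣≤ {A * (b₂ - h * a₂)} {s * (b₁ - h * a₁)} (∣p*q∣≤ (<⇒≤ (α-pos 1≤ρ (suc (suc n)))) (b≈ζa′ n))
         (∣p*q∣≤ (<⇒≤ (σ-pos 1≤ρ (suc (suc n)))) (≤-trans (b≈ζa n)
           (*-monoˡ-≤₀ (<⇒≤ (a-pos (suc n))) (p≤p+q e (inv-nonNeg (0<κ n)))))) ⟩
  A * (a₂ * (e + e)) + s * (a₁ * (e + e))
    ≡⟨ solve 5 (λ A a₂ s a₁ f → A :* (a₂ :* f) :+ s :* (a₁ :* f) := (A :* a₂ :+ s :* a₁) :* f) refl A a₂ s a₁ (e + e) ⟩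
  q * (e + e) ∎)
  where
  open ≤-Reasoning
  A s p q h e a₁ a₂ b₁ b₂ : ℚ
  A = α (κ ρ) (κ (suc (suc n)))
  s = σ (κ ρ) (κ (suc (suc n)))
  p = Q b ρ (suc n)
  q = Q a ρ (suc n)
  h = zeta3Partial (suc n)
  e = inv (κ (suc n))
  a₁ = a (suc n)
  a₂ = a (suc (suc n))
  b₁ = b (suc n)
  b₂ = b (suc (suc n))
  0<q : 0ℚ < q
  0<q = Q-pos 1≤ρ (suc n)

-- The product is the numerator of ε, a positive integer.
archimedean : ∀ ε → Positive ε → 1ℚ ≤ ε * κ (↧ₙ ε)
archimedean ε@(mkℚ ℤ.+[1+ p ] m _) _ = toℚᵘ-cancel-≤ (ℚᵘ.≤-respʳ-≃
  (ℚᵘ.≃-sym (ℚᵘ.≃-trans (toℚᵘ-homo-* ε (κ (suc m))) (ℚᵘ.*-congˡ {toℚᵘ ε} (toℚᵘ-fromℚᵘ (mkℚᵘ (+ suc m) 0)))))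
  (ℚᵘ.*≤* (ℤ.+≤+ bound)))
  where
  bound : suc m ℕ.* 1 ℕ.+ 0 ℕ.≤ suc p ℕ.* suc m ℕ.* 1
  bound = subst₂ ℕ._≤_ (sym (trans (ℕ.+-identityʳ (suc m ℕ.* 1)) (ℕ.*-identityʳ (suc m))))
    (sym (ℕ.*-identityʳ (suc p ℕ.* suc m))) (ℕ.m≤n*m (suc m) (suc p))

theorem4 : (ρ : ℕ) → 1 ℕ.≤ ρ → (ε : ℚ) → 0ℚ < ε →
    ∃ λ N → (M : ℕ) → N ℕ.≤ M →
    ∣ zeta3Partial M - (const ρ + seriesPartial ρ M) ∣ < ε
theorem4 ρ 1≤ρ ε 0<ε = N , bound
  where
  open ≤-Reasoning
  q N : ℕ
  q = ↧ₙ ε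
  -- The error is 2/M, and 1/ε ≤ q gives 2/ε ≤ 2q; the successor makes the inequality strict and
  -- excludes M = 0.
  N = suc (q ℕ.+ q)
  bound : ∀ M → N ℕ.≤ M → ∣ zeta3Partial M - (const ρ + seriesPartial ρ M) ∣ < ε
  bound (suc m) N≤M = begin-strict
    ∣ zeta3Partial (suc m) - (const ρ + seriesPartial ρ (suc m)) ∣
      ≡⟨ cong (λ z → ∣ zeta3Partial (suc m) - z ∣) (partial-sum 1≤ρ (suc m)) ⟩
    ∣ zeta3Partial (suc m) - convergent ρ (suc m) ∣  ≤⟨ convergent-error 1≤ρ m ⟩
    inv x + inv x  <⟨ *-cancelˡ-<-nonNeg x {{nonNegative (0≤κ (suc m))}} x*2/x<x*ε ⟩
    ε ∎
    where
    x : ℚ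
    x = κ (suc m)
    x*2/x<x*ε : x * (inv x + inv x) < x * ε
    x*2/x<x*ε = begin-strict
      x * (inv x + inv x)          ≡⟨ *-distribˡ-+ x (inv x) (inv x) ⟩
      x * inv x + x * inv x        ≡⟨ cong (λ z → z + z) (inv-right (pos⇒≢0 (0<κ m))) ⟩
      1ℚ + 1ℚ                      ≤⟨ +-mono-≤ (archimedean ε (positive 0<ε)) (archimedean ε (positive 0<ε)) ⟩
      ε * κ q + ε * κ q            ≡⟨ trans (sym (*-distribˡ-+ ε (κ q) (κ q))) (cong (ε *_) (sym (κ-+ q q))) ⟩
      ε * κ (q ℕ.+ q)              <⟨ *-monoʳ-<-pos ε {{positive 0<ε}} (subst (κ (q ℕ.+ q) <_) (sym (κ-suc (q ℕ.+ q)))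
                                        (subst (_< κ (q ℕ.+ q) + 1ℚ) (+-identityʳ (κ (q ℕ.+ q))) (+-monoʳ-< (κ (q ℕ.+ q)) 0<1))) ⟩
      ε * κ N                      ≤⟨ *-monoˡ-≤₀ (<⇒≤ 0<ε) (κ-mono N≤M) ⟩
      ε * x                        ≡⟨ *-comm ε x ⟩
      x * ε ∎
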